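{- There is an algorithm that, given a definite Horn CNF $\Psi$ over the variable set $V$, decides in $O(|V|^4\cdot|\Psi|\cdot\|\Psi\|)$ time whether the function represented by $\Psi$ is hypergraph Horn, and if yes, constructs (within the same time bound) a hypergraph $\mathcal{H}\subseteq 2^V$ such that $\Psi=\Phi_{\mathcal{H}}$ (as Boolean functions) and $|\mathcal{H}|\le|V|\cdot|\Psi|$.
   Context: $V$ is a finite set of Boolean variables; a Boolean function on $V$ is a map $2^V\to\{0,1\}$, and its true sets are the sets on which it equals $1$. For $B\subsetneq V$ and $v\in V\setminus B$, the definite Horn clause $B\to v$, i.e. the clause $v\vee\bigvee_{u\in B}\overline{u}$, has as true sets the sets $T$ with $B\not\subseteq T$ or $B\cup\{v\}\subseteq T$. A definite Horn CNF $\Psi=\bigwedge_k C_k$ is a finite conjunction of definite Horn clauses; $|\Psi|$ is its number of clauses and $\|\Psi\|=\sum_k|C_k|$ its length, where $|C_k|$ is the number of literals in $C_k$. For a hypergraph $\mathcal{H}\subseteq 2^V$, let $\Phi_{\mathcal{H}}=\bigwedge_{H\in\mathcal{H}}\bigwedge_{v\in H}((H\setminus\{v\})\to v)$ (the empty conjunction is the constant $1$). A Boolean function is hypergraph Horn if it equals $\Phi_{\mathcal{H}}$ for some hypergraph $\mathcal{H}\subseteq 2^V$. -}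

module Defs where

open import Data.Bool.Base using (Bool; if_then_else_)
open import Data.Bool.ListAction using (all)
open import Data.Fin.Base using (Fin; zero; suc; toℕ)
open import Data.Fin.Subset using (Subset; _∉_; _∪_; ⁅_⁆; _-_; ∣_∣)
open import Data.Fin.Subset.Properties using (_∈?_; _⊆?_)
open import Data.List.Base using (List; []; _∷_; _++_; map; concatMap; filter; allFin; applyUpTo; length)
open import Data.List.Relation.Unary.Unique.Propositional using (Unique)
open import Data.Nat.Base using (ℕ; zero; suc; _+_; _∸_)
open import Data.Nat.ListAction using (sum)
open import Data.Nat.Properties using (_≟_)
open import Data.Product.Base using (∃-syntax)
open import Data.Vec.Base using (_∷_; here; there)
open import Relation.Binary.PropositionalEquality using (_≡_; _≢_; _≗_)
open import Relation.Nullary.Decidable using (⌊_⌋; ¬?; _⊎-dec_)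

-- The variable set is V = Fin n, and 2^V is Subset n.

BoolFun : ℕ → Set
BoolFun n = Subset n → Bool

-- The clause B → v.  Since v ∉ B, the body is automatically a proper subset.

record Clause (n : ℕ) : Set where
  constructor clause
  field
    body      : Subset n
    head      : Fin n
    head∉body : head ∉ body

open Clause public

⟦_⟧ᶜ : ∀ {n} → Clause n → BoolFun n
⟦ clause B v _ ⟧ᶜ T = ⌊ ¬? (B ⊆? T) ⊎-dec ((B ∪ ⁅ v ⁆) ⊆? T) ⌋

-- The number of literals of v ∨ ⋁_{u ∈ B} ū.

width : ∀ {n} → Clause n → ℕ
width C = suc ∣ body C ∣

CNF : ℕ → Set
CNF n = List (Clause n)

⟦_⟧ : ∀ {n} → CNF n → BoolFun n
⟦ Ψ ⟧ T = all (λ C → ⟦ C ⟧ᶜ T) Ψ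

∥_∥ : ∀ {n} → CNF n → ℕ
∥ Ψ ∥ = sum (map width Ψ)

record Hypergraph (n : ℕ) : Set where
  constructor hypergraph
  field
    edges    : List (Subset n)
    distinct : Unique edges

open Hypergraph public

card : ∀ {n} → Hypergraph n → ℕ
card ℋ = length (edges ℋ)

-- Lists each element once, in increasing order.

elements : ∀ {n} → Subset n → List (Fin n)
elements {n} p = filter (_∈? p) (allFin n)

x∉p-x : ∀ {n} (p : Subset n) (x : Fin n) → x ∉ p - x
x∉p-x (_ ∷ p) (suc x) (there x∈) = x∉p-x p x x∈

edgeClauses : ∀ {n} → Subset n → CNF n
edgeClauses H = map (λ v → clause (H - v) v (x∉p-x H v)) (elements H)

Φ : ∀ {n} → Hypergraph n → CNF n
Φ ℋ = concatMap edgeClauses (edges ℋ)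

HypergraphHorn : ∀ {n} → BoolFun n → Set
HypergraphHorn {n} f = ∃[ ℋ ] f ≗ ⟦ Φ {n} ℋ ⟧

-- Machine model: a uniform-cost RAM whose only arithmetic is + and ∸,
-- programmed by structured while programs.

-- Memory is a family of unbounded arrays of naturals.  Array names are
-- constants in the program text, so a program touches only finitely many
-- arrays; interleaving them in one memory costs a constant factor.

Store : Set
Store = ℕ → ℕ → ℕ

_[_,_↦_] : Store → ℕ → ℕ → ℕ → Store
(σ [ x , i ↦ k ]) y j = if ⌊ y ≟ x ⌋ then (if ⌊ j ≟ i ⌋ then k else σ y j) else σ y j

infixl 6 _⊕_ _⊖_

data Exp : Set where
  lit     : ℕ → Exp
  _at_    : ℕ → Exp → Exp
  _⊕_ _⊖_ : Exp → Exp → Exp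

eval : Exp → Store → ℕ
eval (lit k)  σ = k
eval (x at e) σ = σ x (eval e σ)
eval (e ⊕ e′) σ = eval e σ + eval e′ σ
eval (e ⊖ e′) σ = eval e σ ∸ eval e′ σ

-- One step per node: no operation is free.

cost : Exp → ℕ
cost (lit k)  = 1
cost (x at e) = suc (cost e)
cost (e ⊕ e′) = suc (cost e + cost e′)
cost (e ⊖ e′) = suc (cost e + cost e′)

infixr 4 _⨾_

data Program : Set where
  skip       : Program
  set_at_to_ : ℕ → Exp → Exp → Program
  _⨾_        : Program → Program → Program
  ifte       : Exp → Program → Program → Program
  while      : Exp → Program → Program

infix 3 _,_⇓[_]_

-- p , σ ⇓[ t ] σ′ : started in σ, p halts in σ′ after exactly t steps.
-- A test succeeds when its value is nonzero.

data _,_⇓[_]_ : Program → Store → ℕ → Store → Set where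

  ⇓skip : ∀ {σ} → skip , σ ⇓[ 1 ] σ

  ⇓set : ∀ {x i e σ} →
    set x at i to e , σ ⇓[ suc (cost i + cost e) ] σ [ x , eval i σ ↦ eval e σ ]

  ⇓seq : ∀ {p q σ σ′ σ″ s t} →
    p , σ ⇓[ s ] σ′ → q , σ′ ⇓[ t ] σ″ →
    p ⨾ q , σ ⇓[ s + t ] σ″

  ⇓then : ∀ {e p q σ σ′ t} → eval e σ ≢ 0 →
    p , σ ⇓[ t ] σ′ →
    ifte e p q , σ ⇓[ suc (cost e + t) ] σ′

  ⇓else : ∀ {e p q σ σ′ t} → eval e σ ≡ 0 →
    q , σ ⇓[ t ] σ′ →
    ifte e p q , σ ⇓[ suc (cost e + t) ] σ′

  ⇓done : ∀ {e p σ} → eval e σ ≡ 0 →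
    while e p , σ ⇓[ suc (cost e) ] σ

  ⇓loop : ∀ {e p σ σ′ σ″ s t} → eval e σ ≢ 0 →
    p , σ ⇓[ s ] σ′ → while e p , σ′ ⇓[ t ] σ″ →
    while e p , σ ⇓[ suc (cost e + (s + t)) ] σ″

encodeSet : ∀ {n} → Subset n → List ℕ
encodeSet p = ∣ p ∣ ∷ map toℕ (elements p)

encodeClause : ∀ {n} → Clause n → List ℕ
encodeClause C = toℕ (head C) ∷ encodeSet (body C)

encodeCNF : ∀ {n} → CNF n → List ℕ
encodeCNF {n} Ψ = n ∷ length Ψ ∷ concatMap encodeClause Ψ

encodeHypergraph : ∀ {n} → Hypergraph n → List ℕ
encodeHypergraph ℋ = card ℋ ∷ concatMap encodeSet (edges ℋ)

nth : List ℕ → ℕ → ℕ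
nth []       _       = 0
nth (x ∷ xs) zero    = x
nth (x ∷ xs) (suc i) = nth xs i

-- The input is placed at the start of array 0; all other cells are 0.

initial : List ℕ → Store
initial xs zero    = nth xs
initial xs (suc _) = λ _ → 0

-- The output is read from the start of array 1.  All encodings are
-- self-delimiting, so a final store has at most one reading.

Outputs : Store → List ℕ → Set
Outputs σ ys = applyUpTo (σ 1) (length ys) ≡ ys

answerNo : List ℕ
answerNo = 0 ∷ []

answerYes : ∀ {n} → Hypergraph n → List ℕ
answerYes ℋ = 1 ∷ encodeHypergraph ℋ

-- Write F for forward chaining with Ψ.  A set H is an edge of some representation
-- iff every v ∈ H lies in F (H - v).  For a clause B → v put Z = F B and start from
-- T = B.  Repeatedly close T under the clauses whose bodies have a smaller closure
-- than Z, then look for u ∈ Z ∖ T with w ∈ F ((T - w) ∪ ⁅ u ⁆) for all w ∈ T: then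
-- T ∪ ⁅ u ⁆ is an edge, and T grows by u.  By induction on ∣ Z ∣, once T = Z for all
-- clauses, the edges found imply Ψ.  If no u exists, Ψ is not hypergraph Horn.
-- Each of the ∣Ψ∣ · n rounds tests at most n² pairs (u , w), and n passes over Ψ
-- compute a closure, which gives n⁴ · ∣Ψ∣ · ∥Ψ∥ steps and at most n · ∣Ψ∣ edges.

module Submission where

open import Defs
open import Data.Bool.Base using (Bool; true; false; T; not; _∧_; if_then_else_)
open import Data.Fin.Base using (Fin; zero; suc; toℕ; fromℕ<)
open import Data.Fin.Properties using (toℕ<n; toℕ-injective; toℕ-fromℕ<) renaming (_≟_ to _≟ᶠ_)
open import Data.Fin.Subset using (Subset; _∈_; _∉_; _⊆_; _∪_; _∩_; ⁅_⁆; _-_; ∣_∣) renaming (⊥ to ∅)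
open import Data.Fin.Subset.Properties
open import Data.List.Base using (List; []; _∷_; _++_; [_]; length; map; filter; concatMap; replicate; allFin; applyUpTo; tabulate)
open import Data.List.Membership.Propositional using () renaming (_∈_ to _∈ˡ_; _∉_ to _∉ˡ_)
open import Data.List.Membership.Propositional.Properties using (∈-map⁺; ∈-map⁻; ∈-concatMap⁺; ∈-concatMap⁻; ∈-filter⁺; ∈-filter⁻; ∈-allFin; ∈-++⁺ˡ; ∈-++⁺ʳ; ∈-++⁻)
open import Data.List.Properties using (length-++; length-map; length-replicate; length-tabulate; map-++; concatMap-++; ++-assoc; ++-identityʳ; filter-accept; filter-reject)
open import Data.List.Relation.Unary.All as All using (All; []; _∷_)
open import Data.List.Relation.Unary.All.Properties using () renaming (++⁺ to All-++)
open import Data.List.Relation.Unary.Any as Any using (Any; here; there)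
open import Data.List.Relation.Unary.Unique.Propositional using (Unique; []; _∷_)
open import Data.List.Relation.Unary.Unique.Propositional.Properties using () renaming (++⁺ to Unique-++)
open import Data.Nat.Base
open import Data.Nat.Induction using (<-rec)
open import Data.Nat.ListAction using (sum)
open import Data.Nat.Properties
open import Data.Nat.Solver using (module +-*-Solver)
open import Data.Product.Base using (_×_; _,_; proj₁; proj₂; ∃-syntax)
open import Data.Sum.Base using (_⊎_; inj₁; inj₂)
open import Data.Unit.Base using (tt) renaming (⊤ to Unit)
open import Data.Vec.Base as Vec using ([]; _∷_; here; there)
open import Data.Vec.Properties using (lookup∘tabulate; tabulate-cong; lookup⇒[]=; []=⇒lookup)
open import Function.Base using (_∘_; id; case_of_; it)
open import Relation.Binary.PropositionalEquality hiding ([_])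
open import Relation.Nullary.Decidable using (Dec; yes; no; ⌊_⌋; _×-dec_; ¬?)
open import Relation.Nullary.Negation.Core using (¬_; contradiction)

-- The rounds use no backtracking. Stuckness at `T` refutes every representation whatever elements
-- were added before; it requires only that `T` lies between `B` and `F B` and is closed under the
-- clauses of smaller closure. That closure is also what makes a clause violated at `T` generate all
-- of `F B`. Clauses are treated in input order, not by size. What is recorded for a clause is
-- conditional on the clauses of smaller closure, and the induction that discharges this condition
-- takes place only in the final semantic argument. The program itself needs just the sizes of all
-- closures, tabulated beforehand, so that eligibility of a clause is a single subtraction. One
-- program text serves all `n`, so a time bound is a numeral times a scale in `n` and `L`.
-- Correctness and time are proved together, because the lengths of loops depend on values in the
-- store.

-- A program logic with time bounds and syntactic frames.

module CostLogic where

  -- Boolean-valued, so that for a concrete program and array name `T (fresh y p)` evaluates to the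
  -- unit type and its proof is filled in silently.
  fresh : ℕ → Program → Bool
  fresh y skip            = true
  fresh y (set x at _ to _) = not ⌊ y ≟ x ⌋
  fresh y (p ⨾ q)         = fresh y p ∧ fresh y q
  fresh y (ifte _ p q)    = fresh y p ∧ fresh y q
  fresh y (while _ p)     = fresh y p

  T-∧⁻ : ∀ a {b} → T (a ∧ b) → T a × T b
  T-∧⁻ true t = tt , t

  set-fresh : ∀ {σ x i k} y → T (not ⌊ y ≟ x ⌋) → (σ [ x , i ↦ k ]) y ≡ σ y
  set-fresh {σ} {x} {i} {k} y = go ⌊ y ≟ x ⌋
    where
    go : ∀ b → T (not b) →
         (λ j → if b then (if ⌊ j ≟ i ⌋ then k else σ y j) else σ y j) ≡ σ y
    go false _ = refl

  ⇓-fresh : ∀ {p σ t τ} → p , σ ⇓[ t ] τ → ∀ y → T (fresh y p) → τ y ≡ σ y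
  ⇓-fresh ⇓skip y _ = refl
  ⇓-fresh (⇓set {σ = σ}) y f = set-fresh {σ} y f
  ⇓-fresh (⇓seq {p = p} d e) y f with T-∧⁻ (fresh y p) f
  ... | f₁ , f₂ = trans (⇓-fresh e y f₂) (⇓-fresh d y f₁)
  ⇓-fresh (⇓then {p = p} _ d) y f = ⇓-fresh d y (proj₁ (T-∧⁻ (fresh y p) f))
  ⇓-fresh (⇓else {p = p} _ d) y f = ⇓-fresh d y (proj₂ (T-∧⁻ (fresh y p) f))
  ⇓-fresh (⇓done _) y f = refl
  ⇓-fresh (⇓loop _ d e) y f = trans (⇓-fresh e y f) (⇓-fresh d y f)

  record Frame (p : Program) (σ τ : Store) : Set where
    constructor frame
    field same : ∀ y {_ : T (fresh y p)} → τ y ≡ σ y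

  open Frame public

  -- X is the scale (an expression in the input parameters) and K the constant.

  record Run (X K : ℕ) (p : Program) (σ : Store) (Q : Store → Set) : Set where
    constructor ran
    field
      {time}  : ℕ
      {final} : Store
      exec    : p , σ ⇓[ time ] final
      bound   : time ≤ K * X
      post    : Q final

    framed : Frame p σ final
    framed = frame λ y {f} → ⇓-fresh exec y f

  private
    variable
      X Y K K₁ K₂ : ℕ
      p q : Program
      σ : Store
      e : Exp
      Q R : Store → Set

  k≤k*X : ∀ k X → .⦃ NonZero X ⦄ → k ≤ k * X
  k≤k*X k X = m≤m*n k X

  run-skip : .⦃ NonZero X ⦄ → Q σ → Run X 1 skip σ Q
  run-skip {X} h = ran ⇓skip (k≤k*X 1 X) h

  run-set : ∀ {x i} → .⦃ NonZero X ⦄ → Q (σ [ x , eval i σ ↦ eval e σ ]) →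
            Run X (suc (cost i + cost e)) (set x at i to e) σ Q
  run-set {X} h = ran ⇓set (k≤k*X _ X) h

  run-seq : Run X K₁ p σ R → (∀ {τ} → Frame p σ τ → R τ → Run X K₂ q τ Q) →
            Run X (K₁ + K₂) (p ⨾ q) σ Q
  run-seq {X} {K₁} {K₂ = K₂} r@(ran d b h) k with k (Run.framed r) h
  ... | ran d′ b′ h′ = ran (⇓seq d d′)
          (≤-trans (+-mono-≤ b b′) (≤-reflexive (sym (*-distribʳ-+ X K₁ K₂)))) h′

  run-set⨾ : ∀ {x i} → .⦃ NonZero X ⦄ → Run X K q (σ [ x , eval i σ ↦ eval e σ ]) Q →
             Run X (suc (cost i + cost e) + K) (set x at i to e ⨾ q) σ Q
  run-set⨾ {σ = σ} {e = e} {x = x} {i} r =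
    run-seq (run-set {Q = λ τ → τ ≡ σ [ x , eval i σ ↦ eval e σ ]} {e = e} {x} {i} refl) λ { _ refl → r }

  run-if : .⦃ NonZero X ⦄ → (eval e σ ≢ 0 → Run X K₁ p σ Q) → (eval e σ ≡ 0 → Run X K₂ q σ Q) →
           Run X (suc (cost e) + (K₁ + K₂)) (ifte e p q) σ Q
  run-if {X} {e} {σ} {K₁} {K₂ = K₂} t f with eval e σ ≟ 0
  ... | no ≢0 with t ≢0
  ...   | ran d b h = ran (⇓then ≢0 d) (≤-trans
            (+-mono-≤ (k≤k*X (suc (cost e)) X) (≤-trans b (*-monoˡ-≤ X (m≤m+n K₁ K₂))))
            (≤-reflexive (sym (*-distribʳ-+ X (suc (cost e)) (K₁ + K₂))))) h
  run-if {X} {e} {σ} {K₁} {K₂ = K₂} t f | yes ≡0 with f ≡0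
  ...   | ran d b h = ran (⇓else ≡0 d) (≤-trans
            (+-mono-≤ (k≤k*X (suc (cost e)) X) (≤-trans b (*-monoˡ-≤ X (m≤n+m K₂ K₁))))
            (≤-reflexive (sym (*-distribʳ-+ X (suc (cost e)) (K₁ + K₂))))) h

  conseq : Run X K p σ Q → (∀ {τ} → Frame p σ τ → Q τ → R τ) → Run X K p σ R
  conseq r@(ran d b h) f = ran d b (f (Run.framed r) h)

  -- Constants are closed numerals, so the inequality is settled by evaluation. The round figures in
  -- later bounds, such as 150 or 200, are arbitrary numerals above the computed sums.
  weaken : {le : T (K₁ ≤ᵇ K₂)} → Run X K₁ p σ Q → Run X K₂ p σ Q
  weaken {K₁} {K₂} {X} {le = k} (ran d b h) = ran d (≤-trans b (*-monoˡ-≤ X (≤ᵇ⇒≤ K₁ K₂ k))) h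

  rescale : X ≤ Y → Run X K p σ Q → Run Y K p σ Q
  rescale {K = K} le (ran d b h) = ran d (≤-trans b (*-monoʳ-≤ K le)) h

  unsuc : .⦃ NonZero X ⦄ → Run (suc X) K p σ Q → Run X (K + K) p σ Q
  unsuc {X} {K} (ran d b h) = ran d (begin
    _              ≤⟨ b ⟩
    K * suc X      ≡⟨ *-suc K X ⟩
    K + K * X      ≤⟨ +-monoˡ-≤ (K * X) (k≤k*X K X) ⟩
    K * X + K * X  ≡⟨ *-distribʳ-+ X K K ⟨
    (K + K) * X    ∎) h
    where open ≤-Reasoning

  -- The counter runs down and is the number of iterations still to come.

  countdown : ℕ → Program → Program
  countdown x b = while (x at lit 0) (set x at lit 0 to (x at lit 0 ⊖ lit 1) ⨾ b)

  for : ℕ → Exp → Program → Program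
  for x e b = set x at lit 0 to e ⨾ countdown x b

  set-hit : ∀ σ x i k → (σ [ x , i ↦ k ]) x i ≡ k
  set-hit σ x i k with x ≟ x | i ≟ i
  ... | yes _ | yes _ = refl
  ... | no ≢  | _     = contradiction refl ≢
  ... | _     | no ≢  = contradiction refl ≢

  set-miss : ∀ σ x {i j} k → j ≢ i → (σ [ x , i ↦ k ]) x j ≡ σ x j
  set-miss σ x {i} {j} k j≢i with x ≟ x | j ≟ i
  ... | yes _ | yes j≡i = contradiction j≡i j≢i
  ... | yes _ | no _    = refl
  ... | no _  | _       = refl

  -- Loading the counter costs 2 + c and the last, failing test 3. Each iteration pays 3 for its
  -- test and 6 for the decrement.
  for-bound : ∀ c k {s S} → .⦃ NonZero S ⦄ → s ≤ S → 5 + c + (9 + k) * s ≤ (14 + c + k) * S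
  for-bound c k {s} {S} s≤S = begin
    5 + c + (9 + k) * s        ≤⟨ +-mono-≤ (k≤k*X (5 + c) S) (*-monoʳ-≤ (9 + k) s≤S) ⟩
    (5 + c) * S + (9 + k) * S  ≡⟨ *-distribʳ-+ S (5 + c) (9 + k) ⟨
    (5 + c + (9 + k)) * S      ≡⟨ cong (_* S) (trans (sym (+-assoc (5 + c) 9 k)) (cong (_+ k) (+-comm (5 + c) 9))) ⟩
    (14 + c + k) * S           ∎
    where open ≤-Reasoning

  -- The invariant is indexed by the elements still to come, and each element has its own weight, so
  -- bodies of unequal cost add up without loss. With clause widths as weights, a pass over the CNF
  -- costs a multiple of its length.
  module _ {A : Set} (I : List A → Store → Set) (w : A → ℕ) {K x b e} {σ₀ : Store}
           {xb : T (fresh x b)}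
           (stable : ∀ {as σ v} → I as σ → I as (σ [ x , 0 ↦ v ]))
           (step : ∀ a as {σ} → Frame (for x e b) σ₀ σ → σ x 0 ≡ length as →
                   I (a ∷ as) σ → 1 ≤ w a × Run (w a) K b σ (I as))
    where

    private
      W = for x e b

      Frame-step : ∀ {σ τ} v → Frame W σ₀ σ → Frame b (σ [ x , 0 ↦ v ]) τ → Frame W σ₀ τ
      Frame-step {σ} v f g = frame λ y {fr} →
        let fr₁ , fr₂ = T-∧⁻ (not ⌊ y ≟ x ⌋) fr
        in trans (same g y {proj₂ (T-∧⁻ (not ⌊ y ≟ x ⌋) fr₂)})
                 (trans (set-fresh {σ} y fr₁) (same f y {fr}))

      Frame-set : ∀ {σ v} → Frame W σ₀ σ → Frame W σ₀ (σ [ x , 0 ↦ v ])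
      Frame-set {σ} f = frame λ y {fr} →
        trans (set-fresh {σ} y (proj₁ (T-∧⁻ (not ⌊ y ≟ x ⌋) fr))) (same f y {fr})

      countdown-list : ∀ as {σ} → Frame W σ₀ σ → σ x 0 ≡ length as → I as σ →
                       ∃[ t ] ∃[ τ ] (countdown x b , σ ⇓[ t ] τ) ×
                                     t ≤ 3 + (9 + K) * sum (map w as) × I as σ × I [] τ
      countdown-list [] {σ} f eq i = _ , _ , ⇓done eq , m≤m+n 3 _ , i , i
      countdown-list (a ∷ as) {σ} f eq i =
        let v   = σ x 0 ∸ 1
            σ₁  = σ [ x , 0 ↦ v ]
            x₁  = trans (set-hit σ x 0 v) (cong (_∸ 1) eq)
            (w≥1 , r@(ran d bd h)) = step a as (Frame-set {σ} {v} f) x₁ (stable {σ = σ} {v} i)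
            f₂  = Frame-step {σ} v f (Run.framed r)
            x₂  = trans (cong (λ g → g 0) (same (Run.framed r) x {xb})) x₁
            (t , τ , d′ , bd′ , _ , j) = countdown-list as f₂ x₂ h
        in  _ , _ , ⇓loop (λ z → 1+n≢0 (trans (sym eq) z)) (⇓seq ⇓set d) d′ ,
            (begin
              3 + (6 + Run.time r + t)                      ≤⟨ +-monoʳ-≤ 3 (+-mono-≤ (+-monoʳ-≤ 6 bd) bd′) ⟩
              3 + (6 + K * w a + (3 + (9 + K) * sum (map w as))) ≡⟨ lem (K * w a) _ ⟩
              -- Weights are at least 1, so the 9 administrative steps are charged to the weight.
              3 + ((9 + K * w a) + (9 + K) * sum (map w as)) ≤⟨ +-monoʳ-≤ 3 (+-monoˡ-≤ _ (+-monoˡ-≤ _ (m≤m*n 9 (w a) ⦃ >-nonZero w≥1 ⦄))) ⟩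
              3 + ((9 * w a + K * w a) + (9 + K) * sum (map w as)) ≡⟨ cong (λ z → 3 + (z + (9 + K) * sum (map w as))) (*-distribʳ-+ (w a) 9 K) ⟨
              3 + ((9 + K) * w a + (9 + K) * sum (map w as)) ≡⟨ cong (3 +_) (*-distribˡ-+ (9 + K) (w a) _) ⟨
              3 + (9 + K) * (w a + sum (map w as)) ∎) ,
            i , j
        where
        open ≤-Reasoning
        lem : ∀ u s → 3 + (6 + u + (3 + s)) ≡ 3 + ((9 + u) + s)
        lem u s = cong (9 +_) (trans (sym (+-assoc u 3 s)) (trans (cong (_+ s) (+-comm u 3)) refl))

      for-list : ∀ as → eval e σ₀ ≡ length as → I as σ₀ →
                 ∃[ t ] ∃[ τ ] (for x e b , σ₀ ⇓[ t ] τ) ×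
                               t ≤ (5 + cost e) + (9 + K) * sum (map w as) × I [] τ
      for-list as n i =
        let v = eval e σ₀
            (t , τ , d , bd , _ , j) =
              countdown-list as {σ₀ [ x , 0 ↦ v ]} (Frame-set {σ₀} {v} (frame λ _ → refl))
                (trans (set-hit σ₀ x 0 v) n) (stable {σ = σ₀} {v} i)
        in _ , _ , ⇓seq ⇓set d , ≤-trans (+-monoʳ-≤ (2 + cost e) bd)
             (≤-reflexive (trans (sym (+-assoc (2 + cost e) 3 _))
               (cong (_+ (9 + K) * sum (map w as)) (trans (+-comm (2 + cost e) 3) refl)))) , j

    -- The extra unit in the scale pays for the setup and the last test when the list is empty; a
    -- positive sum of weights absorbs them in the primed version.
    run-for-list : ∀ as → eval e σ₀ ≡ length as → I as σ₀ →
                   Run (suc (sum (map w as))) (14 + cost e + K) (for x e b) σ₀ (I [])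
    run-for-list as n i with for-list as n i
    ... | _ , _ , d , bd , j = ran d (≤-trans bd (for-bound (cost e) K (n≤1+n _))) j

    run-for-list′ : ∀ as → .⦃ NonZero (sum (map w as)) ⦄ → eval e σ₀ ≡ length as → I as σ₀ →
                    Run (sum (map w as)) (14 + cost e + K) (for x e b) σ₀ (I [])
    run-for-list′ as n i with for-list as n i
    ... | _ , _ , d , bd , j = ran d (≤-trans bd (for-bound (cost e) K ≤-refl)) j

  sum-const : ∀ {A : Set} (as : List A) c → sum (map (λ _ → c) as) ≡ length as * c
  sum-const []       c = refl
  sum-const (_ ∷ as) c = cong (c +_) (sum-const as c)

  run-for : (I : ℕ → Store → Set) → ∀ {N x e b} → .⦃ NonZero X ⦄ → .⦃ NonZero N ⦄ →
            {xb : T (fresh x b)} →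
            (∀ {i τ v} → I i τ → I i (τ [ x , 0 ↦ v ])) →
            (∀ {i τ} → Frame (for x e b) σ τ → i < N → τ x 0 ≡ i → I (suc i) τ → Run X K b τ (I i)) →
            eval e σ ≡ N → I N σ →
            Run (N * X) (14 + cost e + K) (for x e b) σ (I 0)
  run-for {X} {σ} I {N} {x} {e} {b} {xb = xb} stable step n i =
    subst (λ z → Run z _ (for x e b) σ (I 0)) eq
      (conseq (run-for-list′ I′ (λ _ → X) {xb = xb} (λ {as} {σ} {v} (l , j) → l , stable {τ = σ} {v} j)
        (λ _ as f x≡ (l , j) → >-nonZero⁻¹ X , conseq (step f l x≡ j) λ _ j′ → <⇒≤ l , j′)
        us ⦃ nz ⦄ (trans n (sym (length-replicate N))) (≤-reflexive (length-replicate N) , subst (λ z → I z σ) (sym (length-replicate N)) i))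
        λ _ → proj₂)
    where
    us = replicate N tt
    I′ : List Unit → Store → Set
    -- Carrying the length bound supplies the `i < N` that loop bodies rely on to turn the counter
    -- into an element of `Fin n`.
    I′ as τ = length as ≤ N × I (length as) τ
    eq : sum (map (λ _ → X) us) ≡ N * X
    eq = trans (sum-const us X) (cong (_* X) (length-replicate N))
    nz : NonZero (sum (map (λ _ → X) us))
    nz = subst NonZero (sym eq) (m*n≢0 N X)

open CostLogic

-- Models, closures and the criterion for not being hypergraph Horn.

module HornSemantics where

  private
    variable
      n : ℕ
      S U : Subset n

  Sat : Clause n → Subset n → Set
  Sat C T = body C ⊆ T → head C ∈ T

  Model : CNF n → Subset n → Set
  Model Ψ T = ∀ {C} → C ∈ˡ Ψ → Sat C T

  EdgeModel : List (Subset n) → Subset n → Set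
  EdgeModel es T = ∀ {H} → H ∈ˡ es → ∀ {v} → v ∈ H → H - v ⊆ T → v ∈ T

  x∈p-y⇒x≢y : ∀ {x y} {p : Subset n} → x ∈ p - y → x ≢ y
  x∈p-y⇒x≢y {y = y} {p} x∈ refl = x∉p-x p y x∈

  ∪⁅⁆-least : ∀ {x} → S ⊆ U → x ∈ U → S ∪ ⁅ x ⁆ ⊆ U
  ∪⁅⁆-least {S = S} {U} {x} S⊆ x∈ {y} y∈ with x∈p∪q⁻ S ⁅ x ⁆ y∈
  ... | inj₁ y∈S = S⊆ y∈S
  ... | inj₂ y∈x = subst (_∈ U) (sym (x∈⁅y⁆⇒x≡y x y∈x)) x∈

  clause⁻ : ∀ (C : Clause n) T → ⟦ C ⟧ᶜ T ≡ true → Sat C T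
  clause⁻ (clause B v _) T eq B⊆T with B ⊆? T | (B ∪ ⁅ v ⁆) ⊆? T
  ... | yes _ | yes ⊆T = ⊆T (x∈p∪q⁺ (inj₂ (x∈⁅x⁆ v)))
  ... | no ⊈  | _      = contradiction (λ {x} → B⊆T {x}) ⊈

  clause⁺ : ∀ (C : Clause n) T → Sat C T → ⟦ C ⟧ᶜ T ≡ true
  clause⁺ (clause B v _) T sat with B ⊆? T | (B ∪ ⁅ v ⁆) ⊆? T
  ... | yes _ | yes _ = refl
  ... | yes ⊆T | no ⊈ = contradiction (λ {x} → ∪⁅⁆-least ⊆T (sat ⊆T) {x}) ⊈
  ... | no _  | _     = refl

  model⁻ : ∀ (Ψ : CNF n) T → ⟦ Ψ ⟧ T ≡ true → Model Ψ T
  model⁻ (C ∷ Ψ) T eq C∈ with ⟦ C ⟧ᶜ T in e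
  model⁻ (C ∷ Ψ) T eq (here refl) | true = clause⁻ C T e
  model⁻ (C ∷ Ψ) T eq (there C∈)  | true = model⁻ Ψ T eq C∈

  model⁺ : ∀ (Ψ : CNF n) T → Model Ψ T → ⟦ Ψ ⟧ T ≡ true
  model⁺ []      T m = refl
  model⁺ (C ∷ Ψ) T m rewrite clause⁺ C T (m (here refl)) = model⁺ Ψ T (m ∘ there)

  model? : ∀ (Ψ : CNF n) T → Dec (Model Ψ T)
  model? Ψ T with ⟦ Ψ ⟧ T in e
  ... | true  = yes (λ {C} → model⁻ Ψ T e {C})
  ... | false = no λ m → case trans (sym e) (model⁺ Ψ T m) of λ ()

  edges⁻ : ∀ es → Model (concatMap edgeClauses es) U → EdgeModel es U
  edges⁻ es m {H} H∈ {v} v∈ ⊆U =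
    m (∈-concatMap⁺ edgeClauses (Any.map (λ { refl → ∈-map⁺ _ (∈-filter⁺ (_∈? H) (∈-allFin v) v∈) }) H∈)) ⊆U

  edges⁺ : ∀ es → EdgeModel es U → Model (concatMap edgeClauses es) U
  edges⁺ {n} {U} es m {C} C∈ = go (∈-concatMap⁻ edgeClauses {xs = es} C∈) m
    where
    go : ∀ {es} → Any (λ H → C ∈ˡ edgeClauses H) es → EdgeModel es U → Sat C U
    go {H ∷ es} (here C∈) m with ∈-map⁻ _ C∈
    ... | v , v∈ , refl = m (here refl) (proj₂ (∈-filter⁻ (_∈? H) {xs = allFin n} v∈))
    go (there a) m = go a (m ∘ there)

  same-models : ∀ {Ψ Χ : CNF n} → (∀ T → Model Ψ T → Model Χ T) → (∀ T → Model Χ T → Model Ψ T) →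
                ⟦ Ψ ⟧ ≗ ⟦ Χ ⟧
  same-models {Ψ = Ψ} {Χ} f g T with ⟦ Ψ ⟧ T in e | ⟦ Χ ⟧ T in e′
  ... | true  | true  = refl
  ... | false | false = refl
  ... | true  | false = trans (sym (model⁺ Χ T (f T (model⁻ Ψ T e)))) e′
  ... | false | true  = trans (sym e) (model⁺ Ψ T (g T (model⁻ Χ T e′)))

  -- `E` selects the clauses in force. `Always` gives full forward chaining and `Smaller s` the
  -- partial closure taken in each round; the same program text computes both.
  record Closure (E : Clause n → Set) (Ψ : CNF n) (S W : Subset n) : Set where
    field
      extends : S ⊆ W
      closed  : ∀ {C} → C ∈ˡ Ψ → E C → Sat C W
      least   : ∀ T → (∀ {C} → C ∈ˡ Ψ → E C → Sat C T) → S ⊆ T → W ⊆ T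

  open Closure public

  Always : Clause n → Set
  Always _ = Unit

  module Forcing {n} (Ψ : CNF n) where

    private
      avoids? : ∀ S v → Dec (∃[ T ] Model Ψ T × S ⊆ T × v ∉ T)
      avoids? S v = anySubset? λ T → model? Ψ T ×-dec S ⊆? T ×-dec ¬? (v ∈? T)

    opaque
      -- Only a specification: the program finds F S by n passes over the clauses.

      F : Subset n → Subset n
      F S = Vec.tabulate λ v → not ⌊ avoids? S v ⌋

      ∈F⁻ : ∀ {S v T} → v ∈ F S → Model Ψ T → S ⊆ T → v ∈ T
      ∈F⁻ {S} {v} {T} v∈ m S⊆T with avoids? S v | trans (sym (lookup∘tabulate _ v)) ([]=⇒lookup v∈)
      ... | no ¬a | _ with v ∈? T
      ...   | yes ∈T = ∈T
      ...   | no ∉T  = contradiction (T , (λ {C} → m {C}) , (λ {x} → S⊆T {x}) , ∉T) ¬a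

      ∈F⁺ : ∀ {S v} → (∀ T → Model Ψ T → S ⊆ T → v ∈ T) → v ∈ F S
      ∈F⁺ {S} {v} h = lookup⇒[]= v (F S) (trans (lookup∘tabulate _ v) go)
        where
        go : not ⌊ avoids? S v ⌋ ≡ true
        go with avoids? S v
        ... | no _ = refl
        ... | yes (T , m , S⊆T , ∉T) = contradiction (h T m S⊆T) ∉T

    F-closure : ∀ S → Closure Always Ψ S (F S)
    F-closure S = record
      { extends = λ x∈ → ∈F⁺ λ T m S⊆T → S⊆T x∈
      ; closed  = λ C∈ _ B⊆ → ∈F⁺ λ T m S⊆T → m C∈ λ x∈ → ∈F⁻ (B⊆ x∈) m S⊆T
      ; least   = λ T m S⊆T x∈ → ∈F⁻ x∈ (λ C∈ → m C∈ tt) S⊆T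
      }

    closure≡F : ∀ {S W} → Closure Always Ψ S W → W ≡ F S
    closure≡F {S} {W} c = ⊆-antisym
      (least c (F S) (closed (F-closure S)) (extends (F-closure S)))
      (least (F-closure S) W (closed c) (extends c))

    size : Clause n → ℕ
    size C = ∣ F (body C) ∣

    Good : Subset n → Set
    Good H = ∀ {M v} → Model Ψ M → v ∈ H → H - v ⊆ M → v ∈ M

    Smaller : ℕ → Clause n → Set
    Smaller s C = size C < s

    -- Weaker than being implied by the edges: a round applies smaller clauses of `Ψ` directly,
    -- before any edges for them need exist. `covered⇒model` repays this debt by strong induction on
    -- `size`.
    Covered : List (Subset n) → Clause n → Set
    Covered es C = ∀ {M} → EdgeModel es M → (∀ {C′} → C′ ∈ˡ Ψ → size C′ < size C → Sat C′ M) → Sat C M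

    covered-++ : ∀ {es C} fs → Covered es C → Covered (es ++ fs) C
    covered-++ fs c m = c (m ∘ ∈-++⁺ˡ)

    good⇒model : ∀ {es M} → All Good es → Model Ψ M → EdgeModel es M
    good⇒model g m H∈ = All.lookup g H∈ m

    covered⇒model : ∀ {es M} → All (Covered es) Ψ → EdgeModel es M → Model Ψ M
    covered⇒model {es} {M} cov em {C} C∈ = <-rec (λ k → ∀ {C} → C ∈ˡ Ψ → size C ≡ k → Sat C M)
      (λ { k rec C∈ refl → All.lookup cov C∈ em λ C′∈ lt → rec lt C′∈ refl }) (size C) C∈ refl

    represents : (ℋ : Hypergraph n) → All Good (edges ℋ) → All (Covered (edges ℋ)) Ψ → ⟦ Ψ ⟧ ≗ ⟦ Φ ℋ ⟧
    represents ℋ good cov = same-models {Ψ = Ψ} {Φ ℋ}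
      (λ T m → edges⁺ (edges ℋ) (good⇒model good m))
      (λ T m → covered⇒model cov (edges⁻ (edges ℋ) m))

    -- For v in `T`, removing v from the edge leaves a superset of `(T - v) ∪ ⁅ u ⁆`, as v differs
    -- from u. Removing u leaves a superset of `B`.
    good-edge : ∀ {B T u} → B ⊆ T → u ∈ F B → u ∉ T → (∀ {w} → w ∈ T → w ∈ F ((T - w) ∪ ⁅ u ⁆)) →
                Good (T ∪ ⁅ u ⁆)
    good-edge {B} {T} {u} B⊆T u∈ u∉ h {M} {v} m v∈ ⊆M with x∈p∪q⁻ T ⁅ u ⁆ v∈
    ... | inj₁ v∈T = ∈F⁻ (h v∈T) m (∪⁅⁆-least
            (λ x∈ → ⊆M (x∈p∧x≢y⇒x∈p-y (x∈p∪q⁺ (inj₁ (p─q⊆p T ⁅ v ⁆ x∈))) (x∈p-y⇒x≢y x∈)))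
            (⊆M (x∈p∧x≢y⇒x∈p-y (x∈p∪q⁺ (inj₂ (x∈⁅x⁆ u))) λ { refl → u∉ v∈T })))
    ... | inj₂ v∈u with x∈⁅y⁆⇒x≡y u v∈u
    ... | refl = ∈F⁻ u∈ m λ x∈ → ⊆M (x∈p∧x≢y⇒x∈p-y (x∈p∪q⁺ (inj₁ (B⊆T x∈))) λ { refl → u∉ (B⊆T x∈) })

    Stuck : Subset n → Subset n → Set
    Stuck Z T = ∀ {u} → u ∈ Z → u ∉ T → ∃[ w ] w ∈ T × w ∉ F ((T - w) ∪ ⁅ u ⁆)

    -- An edge H of a representation that is violated at T yields u, and then w and a
    -- model M from Stuck.  If w ∈ H, then M violates H.  Otherwise M ∩ T violates a
    -- clause, whose body then generates all of Z and so puts w into M.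
    stuck⇒¬horn : ∀ {B T u} → B ⊆ T → T ⊆ F B →
                  (∀ {C} → C ∈ˡ Ψ → size C < ∣ F B ∣ → Sat C T) →
                  u ∈ F B → u ∉ T → Stuck (F B) T → ¬ HypergraphHorn ⟦ Ψ ⟧
    stuck⇒¬horn {B} {T} {u₀} B⊆T T⊆Z small u₀∈ u₀∉ stuck (ℋ , eq) =
      -- If the edges held at `T`, then `T` would be a model above `B` and would contain all of
      -- `F B`, including `u₀`.
      u₀∉ (∈F⁻ u₀∈ (edge⇒model T T-model) B⊆T)
      where
      es = edges ℋ

      edge⇒model : ∀ M → EdgeModel es M → Model Ψ M
      edge⇒model M m = model⁻ Ψ M (trans (eq M) (model⁺ (Φ ℋ) M (edges⁺ es m)))

      model⇒edge : ∀ M → Model Ψ M → EdgeModel es M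
      model⇒edge M m = edges⁻ es (model⁻ (Φ ℋ) M (trans (sym (eq M)) (model⁺ Ψ M m)))

      Z-model : Model Ψ (F B)
      Z-model C∈ = closed (F-closure B) C∈ tt

      -- The closure of the body lies in `F B`. Were the inclusion proper, the clause would have a
      -- smaller closure, and `T` is closed under those.
      generates : ∀ {C} → C ∈ˡ Ψ → body C ⊆ T → head C ∉ T → F B ⊆ F (body C)
      generates {C} C∈ ⊆T h∉ {x} x∈ with x ∈? F (body C)
      ... | yes x∈′ = x∈′
      ... | no  x∉′ = contradiction (small C∈ (p⊂q⇒∣p∣<∣q∣ (⊆Z , x , x∈ , x∉′)) ⊆T) h∉
        where
        ⊆Z : F (body C) ⊆ F B
        ⊆Z y∈ = ∈F⁻ y∈ Z-model λ z∈ → T⊆Z (⊆T z∈)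

      T-model : EdgeModel es T
      T-model {H} H∈ {v} v∈H ⊆T with v ∈? T
      ... | yes v∈T = v∈T
      -- `F B` is a model and contains `H - v`, so it contains v; hence stuckness applies to v.
      ... | no  v∉T with stuck (model⇒edge (F B) Z-model H∈ v∈H (λ x∈ → T⊆Z (⊆T x∈))) v∉T
      ... | w , w∈T , w∉ = contradiction (∈F⁺ λ M m ⊆M → case w ∈? M of λ
              { (yes w∈M) → w∈M
              ; (no w∉M) → contradiction (bad M m ⊆M w∉M) w∉M }) w∉
        where
        module _ M (m : Model Ψ M) (⊆M : (T - w) ∪ ⁅ v ⁆ ⊆ M) (w∉M : w ∉ M) where
          v∈M : v ∈ M
          v∈M = ⊆M (x∈p∪q⁺ (inj₂ (x∈⁅x⁆ v)))

          T-w⊆M : T - w ⊆ M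
          T-w⊆M x∈ = ⊆M (x∈p∪q⁺ (inj₁ x∈))

          M∩T-model : Model Ψ (M ∩ T)
          M∩T-model {C} C∈ ⊆M∩T with head C ∈? T
          ... | yes h∈ = x∈p∩q⁺ (m C∈ (λ x∈ → proj₁ (x∈p∩q⁻ M T (⊆M∩T x∈))) , h∈)
          ... | no h∉  = contradiction
            (∈F⁻ (generates C∈ (λ x∈ → proj₂ (x∈p∩q⁻ M T (⊆M∩T x∈))) h∉ (T⊆Z w∈T)) m
              (λ x∈ → proj₁ (x∈p∩q⁻ M T (⊆M∩T x∈)))) w∉M

          bad : w ∈ M
          bad with w ∈? H
          ... | yes w∈H = model⇒edge M m H∈ w∈H λ {x} x∈ → case x ≟ᶠ v of λ
                { (yes refl) → v∈M
                ; (no x≢v) → T-w⊆M (x∈p∧x≢y⇒x∈p-y (⊆T (x∈p∧x≢y⇒x∈p-y (p─q⊆p H ⁅ w ⁆ x∈) x≢v)) (x∈p-y⇒x≢y x∈)) }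
          -- As w is not in `H`, the set `H - v` lies in `T - w`, hence in `M ∩ T`; this model would
          -- force v into `T`.
          ... | no w∉H = contradiction (proj₂ (x∈p∩q⁻ M T (model⇒edge (M ∩ T) M∩T-model H∈ v∈H λ x∈ →
                  x∈p∩q⁺ (T-w⊆M (x∈p∧x≢y⇒x∈p-y (⊆T x∈) λ { refl → w∉H (p─q⊆p H ⁅ v ⁆ x∈) }) , ⊆T x∈)))) v∉T

open HornSemantics

-- Sets and lists as contents of arrays.

module ArrayCoding where

  private
    variable
      n : ℕ
      a b : ℕ → ℕ

  -- For a concrete array name, a write to the store reduces to this on the array concerned, so
  -- facts about single arrays apply to stores by conversion.
  update : (ℕ → ℕ) → ℕ → ℕ → ℕ → ℕ
  update a i k j = if ⌊ j ≟ i ⌋ then k else a j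

  update-hit : ∀ a i k → update a i k i ≡ k
  update-hit a i k with i ≟ i
  ... | yes _ = refl
  ... | no i≢i = contradiction refl i≢i

  update-miss : ∀ a {i j} k → j ≢ i → update a i k j ≡ a j
  update-miss a {i} {j} k j≢i with j ≟ i
  ... | yes eq = contradiction eq j≢i
  ... | no _  = refl

  opaque
    support : (ℕ → ℕ) → Subset n
    support a = Vec.tabulate λ i → not (a (toℕ i) ≡ᵇ 0)

    ∈-support⁺ : ∀ {x : Fin n} → a (toℕ x) ≢ 0 → x ∈ support a
    ∈-support⁺ {a = a} {x} ≢0 = lookup⇒[]= x _ (trans (lookup∘tabulate _ x) (go (a (toℕ x)) ≢0))
      where
      go : ∀ k → k ≢ 0 → not (k ≡ᵇ 0) ≡ true
      go zero    ≢0 = contradiction refl ≢0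
      go (suc _) _  = refl

    ∈-support⁻ : ∀ {x : Fin n} → x ∈ support a → a (toℕ x) ≢ 0
    ∈-support⁻ {a = a} {x} x∈ ≡0 with trans (sym (lookup∘tabulate _ x)) ([]=⇒lookup x∈)
    ... | e rewrite ≡0 = case e of λ ()

    support-cong : (∀ {j} → j < n → a j ≡ b j) → support {n} a ≡ support b
    support-cong h = tabulate-cong λ i → cong (λ k → not (k ≡ᵇ 0)) (h (toℕ<n i))

  support-zero : (∀ {j} → j < n → a j ≡ 0) → support {n} a ≡ ∅
  support-zero h = Empty-unique λ (x , x∈) → ∈-support⁻ x∈ (h (toℕ<n x))

  support-insert : ∀ {i k} (x : Fin n) → i ≡ toℕ x → support (update a i (suc k)) ≡ support a ∪ ⁅ x ⁆
  support-insert {a = a} {i} {k} x refl = ⊆-antisym fwd (∪⁅⁆-least bwd (∈-support⁺ (λ e → case trans (sym (update-hit a i (suc k))) e of λ ())))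
    where
    fwd : support (update a i (suc k)) ⊆ support a ∪ ⁅ x ⁆
    fwd {y} y∈ with y ≟ᶠ x
    ... | yes refl = x∈p∪q⁺ (inj₂ (x∈⁅x⁆ x))
    ... | no y≢x = x∈p∪q⁺ (inj₁ (∈-support⁺ λ e → ∈-support⁻ y∈
                     (trans (update-miss a (suc k) (y≢x ∘ toℕ-injective)) e)))
    bwd : support a ⊆ support (update a i (suc k))
    bwd {y} y∈ with y ≟ᶠ x
    ... | yes refl = ∈-support⁺ (λ e → case trans (sym (update-hit a i (suc k))) e of λ ())
    ... | no y≢x = ∈-support⁺ λ e → ∈-support⁻ y∈
                     (trans (sym (update-miss a (suc k) (y≢x ∘ toℕ-injective))) e)

  support-delete : ∀ {i} (x : Fin n) → i ≡ toℕ x → support (update a i 0) ≡ support a - x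
  support-delete {a = a} {i} x refl = ⊆-antisym fwd bwd
    where
    fwd : support (update a i 0) ⊆ support a - x
    fwd {y} y∈ with y ≟ᶠ x
    ... | yes refl = contradiction (update-hit a i 0) (∈-support⁻ y∈)
    ... | no y≢x = x∈p∧x≢y⇒x∈p-y (∈-support⁺ λ e → ∈-support⁻ y∈
                     (trans (update-miss a 0 (y≢x ∘ toℕ-injective)) e)) y≢x
    bwd : support a - x ⊆ support (update a i 0)
    bwd {y} y∈ = ∈-support⁺ λ e → ∈-support⁻ (p─q⊆p (support a) ⁅ x ⁆ y∈)
      (trans (sym (update-miss a 0 (x∈p-y⇒x≢y y∈ ∘ toℕ-injective))) e)

  bit : ℕ → ℕ
  bit zero    = 0
  bit (suc _) = 1

  bit-suc : ∀ {k} → k ≢ 0 → bit k ≡ 1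
  bit-suc {zero}  ≢0 = contradiction refl ≢0
  bit-suc {suc _} _  = refl

  -- Recursion from the top index suits loops that count down: `count a i` is what remains to be
  -- tallied when the counter is `i`.
  count : (ℕ → ℕ) → ℕ → ℕ
  count a zero    = 0
  count a (suc i) = bit (a i) + count a i

  opaque
    unfolding support

    ∣support∣ : ∀ n (a : ℕ → ℕ) → ∣ support {n} a ∣ ≡ count a n
    ∣support∣ zero    a = refl
    ∣support∣ (suc n) a = trans (lem (a 0) {support (a ∘ suc)}) (trans (cong (bit (a 0) +_) (∣support∣ n (a ∘ suc))) (front n a))
      where
      lem : ∀ k {p : Subset n} → ∣ not (k ≡ᵇ 0) ∷ p ∣ ≡ bit k + ∣ p ∣
      lem zero    = refl
      lem (suc _) = refl
      -- Reconciles vectors, which are consumed from index 0, with `count`, which peels off the top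
      -- index.
      front : ∀ n a → bit (a 0) + count (a ∘ suc) n ≡ count a (suc n)
      front zero    a = refl
      front (suc n) a = trans (sym (+-assoc (bit (a 0)) _ _))
        (trans (cong (_+ count (a ∘ suc) n) (+-comm (bit (a 0)) (bit (a (suc n)))))
        (trans (+-assoc (bit (a (suc n))) _ _) (cong (bit (a (suc n)) +_) (front n a))))

  length-elements : ∀ (p : Subset n) → length (elements p) ≡ ∣ p ∣
  length-elements p = go p id p λ _ → id , id
    where
    -- The tail of a tabulation tabulates a shifted function. So the counted set `q` shrinks along
    -- the recursion while the filter keeps testing the original `p`.
    go : ∀ {m n} (p : Subset n) (f : Fin m → Fin n) (q : Subset m) →
         (∀ x → (f x ∈ p → x ∈ q) × (x ∈ q → f x ∈ p)) →
         length (filter (_∈? p) (tabulate f)) ≡ ∣ q ∣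
    go p f [] h = refl
    go p f (true ∷ q) h =
      trans (cong length (filter-accept (_∈? p) (proj₂ (h zero) here)))
        (cong suc (go p (f ∘ suc) q λ x → (drop-there ∘ proj₁ (h (suc x))) , (proj₂ (h (suc x)) ∘ there)))
    go p f (false ∷ q) h =
      trans (cong length (filter-reject (_∈? p) λ f∈ → case proj₁ (h zero) f∈ of λ ()))
        (go p (f ∘ suc) q λ x → (drop-there ∘ proj₁ (h (suc x))) , (proj₂ (h (suc x)) ∘ there))

  -- Cells of the unbounded memory can be addressed by a whole set, through a numeral
  -- that determines it; so a duplicate edge is found by a single lookup.

  horner : (ℕ → ℕ) → ℕ → ℕ → ℕ
  horner a zero    acc = acc
  horner a (suc i) acc = horner a i (acc + acc + bit (a i))

  key : ℕ → (ℕ → ℕ) → ℕ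
  key n a = horner a n 0

  bit-injective : ∀ k l → bit k ≡ bit l → not (k ≡ᵇ 0) ≡ not (l ≡ᵇ 0)
  bit-injective zero    zero    _ = refl
  bit-injective (suc _) (suc _) _ = refl

  bit-cong : ∀ k l → not (k ≡ᵇ 0) ≡ not (l ≡ᵇ 0) → bit k ≡ bit l
  bit-cong zero    zero    _ = refl
  bit-cong (suc _) (suc _) _ = refl

  -- Quotient and remainder modulo 2 are unique; two units are removed from both sides at a time.
  double-bit-injective : ∀ i j k l → i + i + bit k ≡ j + j + bit l → i ≡ j × bit k ≡ bit l
  double-bit-injective zero    zero    k l e = refl , e
  double-bit-injective zero    (suc j) zero l ()
  double-bit-injective zero    (suc j) (suc k) l e = case trans (suc-injective e) (cong (_+ bit l) (+-suc j j)) of λ ()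
  double-bit-injective (suc i) zero    k (suc l) e = case trans (sym (suc-injective e)) (cong (_+ bit k) (+-suc i i)) of λ ()
  double-bit-injective (suc i) (suc j) k l e
    with double-bit-injective i j k l (suc-injective (suc-injective
           (trans (sym (cong (λ z → suc (z + bit k)) (+-suc i i))) (trans e (cong (λ z → suc (z + bit l)) (+-suc j j))))))
  ... | refl , e′ = refl , e′

  -- The two accumulators must vary independently: the top bits are absorbed into them before the
  -- recursive call, so induction returns equal accumulators, and parity then separates the bits.
  horner-injective : ∀ i {x y} → horner a i x ≡ horner b i y → x ≡ y × (∀ {j} → j < i → bit (a j) ≡ bit (b j))
  horner-injective zero e = e , λ ()
  horner-injective {a} {b} (suc i) {x} {y} e with horner-injective i e
  ... | e′ , h with double-bit-injective x y (a i) (b i) e′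
  ... | x≡y , ai≡bi = x≡y , λ {j} j<1+i → case j ≟ i of λ
          { (yes refl) → ai≡bi
          ; (no j≢i)   → h (≤∧≢⇒< (s≤s⁻¹ j<1+i) j≢i) }

  horner-cong : ∀ i {x} → (∀ {j} → j < i → bit (a j) ≡ bit (b j)) → horner a i x ≡ horner b i x
  horner-cong zero h = refl
  horner-cong {b = b} (suc i) {x} h rewrite h (n<1+n i) = horner-cong {b = b} i (h ∘ m<n⇒m<1+n)

  opaque
    unfolding support

    key-injective : key n a ≡ key n b → support {n} a ≡ support b
    key-injective {n} {a} {b} e = tabulate-cong λ i →
      bit-injective (a (toℕ i)) (b (toℕ i)) (proj₂ (horner-injective n e) (toℕ<n i))

    key-cong : support {n} a ≡ support b → key n a ≡ key n b
    key-cong {n} {a} {b} e = horner-cong n λ {j} j<n → bit-cong (a j) (b j)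
      (subst (λ j → not (a j ≡ᵇ 0) ≡ not (b j ≡ᵇ 0)) (toℕ-fromℕ< j<n)
        (trans (sym (lookup∘tabulate _ (fromℕ< j<n)))
          (trans (cong (λ p → Vec.lookup p (fromℕ< j<n)) e) (lookup∘tabulate _ (fromℕ< j<n)))))

  At : (ℕ → ℕ) → ℕ → List ℕ → Set
  At a q []       = Unit
  At a q (x ∷ xs) = a q ≡ x × At a (suc q) xs

  at-nth : ∀ q xs → (∀ i → a (q + i) ≡ nth xs i) → At a q xs
  at-nth q []       h = _
  at-nth {a} q (x ∷ xs) h = trans (cong a (sym (+-identityʳ q))) (h 0) ,
    at-nth (suc q) xs λ i → trans (cong a (sym (+-suc q i))) (h (suc i))

  at-push : ∀ {q xs i k} → At a q xs → i ≡ q + length xs → At (update a i k) q (xs ++ [ k ])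
  at-push {a} {q} {[]} {k = k} _ refl = trans (cong (update a (q + 0) k) (sym (+-identityʳ q))) (update-hit a (q + 0) k) , _
  at-push {a} {q} {x ∷ xs} {k = k} (e , h) refl =
    trans (update-miss a k (λ e → m≢1+m+n q (trans e (+-suc q (length xs))))) e ,
    subst (λ i → At (update a i k) (suc q) (xs ++ [ k ])) (sym (+-suc q (length xs)))
      (at-push {q = suc q} {xs} h refl)

  at-below : ∀ {q i k} xs → i < q → At a q xs → At (update a i k) q xs
  at-below [] _ _ = _
  at-below {a} {k = k} (x ∷ xs) i<q (e , h) =
    trans (update-miss a k (λ e′ → <-irrefl (sym e′) i<q)) e , at-below xs (m<n⇒m<1+n i<q) h

  at-applyUpTo : ∀ {q f} xs → (∀ i → f i ≡ a (q + i)) → At a q xs → applyUpTo f (length xs) ≡ xs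
  at-applyUpTo []       _ _ = refl
  at-applyUpTo {a} {q} (x ∷ xs) h (e , r) =
    cong₂ _∷_ (trans (h 0) (trans (cong a (+-identityʳ q)) e))
      (at-applyUpTo {q = suc q} xs (λ i → trans (h (suc i)) (cong a (+-suc q i))) r)

  AllAt : ∀ {A : Set} → (ℕ → A → Set) → ℕ → List A → Set
  AllAt P c []       = Unit
  AllAt P c (x ∷ xs) = P c x × AllAt P (suc c) xs

open ArrayCoding

-- Memory layout and text of the program.

at-zero : ∀ {a b : ℕ → ℕ} → a ≡ b → a 0 ≡ b 0
at-zero e = cong (λ f → f 0) e

-- A scalar is an array of which only cell 0 is used.

infix 21 $_
$_ : ℕ → Exp
$ x = x at lit 0

infix 5 _≔_
_≔_ : ℕ → Exp → Program
x ≔ e = set x at lit 0 to e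

input output work current goal sizes seen counter literal clauses rounds : ℕ
input = 0; output = 1; work = 2; current = 3; goal = 4; sizes = 5; seen = 6
counter = 7; literal = 8; clauses = 9; rounds = 10

ptr idx hd ok lim tally pos outer cidx stage cand del missing found good failed edgeCount outPtr code : ℕ
ptr = 11; idx = 12; hd = 13; ok = 14; lim = 15; tally = 16; pos = 17; outer = 18; cidx = 19
stage = 20; cand = 21; del = 22; missing = 23; found = 24; good = 25; failed = 26
edgeCount = 27; outPtr = 28; code = 29

numVars numClauses : Exp
numVars    = input at lit 0
numClauses = input at lit 1

fill : ℕ → Exp → Program
fill b e = for counter numVars (set b at $ counter to e)

copy : ℕ → ℕ → Program
copy a b = fill b (a at $ counter)

testLiteral testClause pass close : Program
testLiteral = ifte (work at (input at $ ptr)) skip (ok ≔ lit 0) ⨾ ptr ≔ lit 1 ⊕ $ ptr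
testClause =
  hd ≔ input at $ ptr ⨾
  -- Truncated subtraction is nonzero exactly when the stored closure size is below `lim`, so one
  -- assignment tests eligibility and initialises the flag.
  ok ≔ $ lim ⊖ sizes at $ idx ⨾
  idx ≔ lit 1 ⊕ $ idx ⨾
  -- Skips the head and the body size; the size is read one cell back.
  ptr ≔ lit 2 ⊕ $ ptr ⨾
  for literal (input at ($ ptr ⊖ lit 1)) testLiteral ⨾
  ifte ($ ok) (set work at $ hd to lit 1) skip
pass = ptr ≔ lit 2 ⨾ idx ≔ lit 0 ⨾ for clauses numClauses testClause
close = for rounds numVars pass

⊈⇒< : ∀ {n} {p q : Subset n} → p ⊆ q → ¬ (q ⊆ p) → ∣ p ∣ < ∣ q ∣
⊈⇒< {p = p} {q} p⊆q q⊈p with ∣ q ∣ ≤? ∣ p ∣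
... | no ≰  = ≰⇒> ≰
... | yes ≤ = contradiction (λ {x} x∈q → case x ∈? p of λ
        { (yes x∈p) → x∈p
        ; (no x∉p)  → contradiction (p⊂q⇒∣p∣<∣q∣ (p⊆q , x , x∈q , x∉p)) (≤⇒≯ ≤) }) q⊈p

-- `load` keeps its own read position `pos`, since every `close` in between rewinds `ptr`.
load tallyWork codeWork emit measure : Program
load =
  fill work (lit 0) ⨾
  pos ≔ lit 2 ⊕ $ pos ⨾
  for literal (input at ($ pos ⊖ lit 1))
    (set work at (input at $ pos) to lit 1 ⨾ pos ≔ lit 1 ⊕ $ pos)
tallyWork = tally ≔ lit 0 ⨾ for counter numVars (ifte (work at $ counter) (tally ≔ lit 1 ⊕ $ tally) skip)
codeWork =
  code ≔ lit 0 ⨾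
  for counter numVars (ifte (work at $ counter) (code ≔ lit 1 ⊕ ($ code ⊕ $ code)) (code ≔ $ code ⊕ $ code))
emit =
  set output at $ outPtr to $ tally ⨾
  outPtr ≔ lit 1 ⊕ $ outPtr ⨾
  -- Elements are written in increasing order while the loop counter decreases, hence a second index
  -- that counts up.
  idx ≔ lit 0 ⨾
  for counter numVars
    (ifte (work at $ idx) (set output at $ outPtr to $ idx ⨾ outPtr ≔ lit 1 ⊕ $ outPtr) skip ⨾
     idx ≔ lit 1 ⊕ $ idx)
measure = load ⨾ close ⨾ tallyWork ⨾ set sizes at $ cidx to $ tally ⨾ cidx ≔ lit 1 ⊕ $ cidx

-- The offset 2 reserves the cells for the verdict and the number of edges, which are known only at
-- the end.
Written : (ℕ → ℕ) → ℕ → List ℕ → Set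
Written a p xs = At a 2 xs × p ≡ 2 + length xs

written-push : ∀ {a p k} xs → Written a p xs → Written (update a p k) (suc p) (xs ++ [ k ])
written-push xs (h , refl) = at-push {q = 2} {xs} h refl ,
  cong (2 +_) (trans (+-comm 1 (length xs)) (sym (length-++ xs)))

Consecutive : ∀ {n} → ℕ → List (Fin n) → Set
Consecutive k xs = AllAt (λ i x → toℕ x ≡ i) k xs

consecutive-allFin : ∀ n → Consecutive 0 (allFin n)
consecutive-allFin n = go n 0 id λ _ → refl
  where
  go : ∀ m k (f : Fin m → Fin n) → (∀ i → toℕ (f i) ≡ k + toℕ i) → Consecutive k (tabulate f)
  go zero    k f h = tt
  go (suc m) k f h = trans (h zero) (+-identityʳ k) , go m (suc k) (f ∘ suc) λ i → trans (h (suc i)) (+-suc k (toℕ i))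

-- With `lim` equal to n + 1 every clause is eligible, because no stored size exceeds n. So `close`
-- computes `F` even while the table of sizes is still incomplete.
measureAll : Program
measureAll = pos ≔ lit 2 ⨾ cidx ≔ lit 0 ⨾ lim ≔ lit 1 ⊕ numVars ⨾ for outer numClauses measure

probe check candidate search : Program
probe =
  ifte (current at $ del)
    (copy current work ⨾ set work at $ del to lit 0 ⨾ set work at $ cand to lit 1 ⨾ close ⨾
     ifte (work at $ del) skip (good ≔ lit 0))
    skip
check = good ≔ lit 1 ⨾ for del numVars probe
candidate =
  ifte (goal at $ cand)
    (ifte (current at $ cand) skip
      -- The candidate is stored shifted by one, so that 0 can mean that none was found.
      (missing ≔ lit 1 ⨾ check ⨾ ifte ($ good) (found ≔ lit 1 ⊕ $ cand) skip))
    skip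
search = missing ≔ lit 0 ⨾ found ≔ lit 0 ⨾ for cand numVars candidate

addEdge round process generate answer main : Program
addEdge =
  set current at ($ found ⊖ lit 1) to lit 1 ⨾ copy current work ⨾ tallyWork ⨾ codeWork ⨾
  -- Another clause may have produced the same set before. It is not listed twice, but `current` has
  -- grown in either case.
  ifte (seen at $ code) skip (set seen at $ code to lit 1 ⨾ edgeCount ≔ lit 1 ⊕ $ edgeCount ⨾ emit)
round =
  copy current work ⨾ lim ≔ sizes at $ cidx ⨾ close ⨾ copy work current ⨾
  lim ≔ lit 1 ⊕ numVars ⨾ search ⨾
  ifte ($ missing) (ifte ($ found) addEdge (failed ≔ lit 1)) skip
process =
  load ⨾ copy work current ⨾ lim ≔ lit 1 ⊕ numVars ⨾ close ⨾ copy work goal ⨾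
  for stage numVars round ⨾ cidx ≔ lit 1 ⊕ $ cidx
generate = pos ≔ lit 2 ⨾ cidx ≔ lit 0 ⨾ outPtr ≔ lit 2 ⨾ for outer numClauses process
answer =
  ifte ($ failed) (set output at lit 0 to lit 0)
    (set output at lit 0 to lit 1 ⨾ set output at lit 1 to $ edgeCount)
main = measureAll ⨾ generate ⨾ answer

opaque

  -- Otherwise conversion checking unfolds products with the numeral.

  main-bound : ℕ
  main-bound = 4000

  main-bound-large : ∀ {k} → T (k ≤ᵇ 4000) → T (k ≤ᵇ main-bound)
  main-bound-large t = t

-- Correctness and running time for a CNF with at least one clause.

module Algorithm {n : ℕ} (Ψ : CNF n) ⦃ _ : NonZero n ⦄ ⦃ _ : NonZero ∥ Ψ ∥ ⦄ where

  open Forcing Ψ public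

  L : ℕ
  L = ∥ Ψ ∥

  instance
    -- Positive scales absorb additive constants, so every bound keeps the form of a numeral times a
    -- product.
    nL≢0 : NonZero (n * L)
    nL≢0 = m*n≢0 n L
    n²L≢0 : NonZero (n * (n * L))
    n²L≢0 = m*n≢0 n (n * L)
    n³L≢0 : NonZero (n * (n * (n * L)))
    n³L≢0 = m*n≢0 n (n * (n * L))
    n⁴L≢0 : NonZero (n * (n * (n * (n * L))))
    n⁴L≢0 = m*n≢0 n (n * (n * (n * L)))

  Loaded : Store → Set
  Loaded σ = σ input ≡ nth (encodeCNF Ψ)

  num-vars : ∀ σ → Loaded σ → eval numVars σ ≡ n
  num-vars σ ld = at-zero ld

  num-clauses : ∀ σ → Loaded σ → eval numClauses σ ≡ length Ψ
  num-clauses σ ld = cong (λ f → f 1) ld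

  input-clauses : ∀ σ → Loaded σ → At (σ input) 2 (concatMap encodeClause Ψ)
  input-clauses σ ld rewrite ld = at-nth 2 _ λ _ → refl

  run-fill : ∀ {σ} b e (g : ℕ → ℕ) → {b≢ : T (not ⌊ b ≟ counter ⌋)} → Loaded σ →
             (∀ {τ} → Frame (fill b e) σ τ → eval e τ ≡ g (τ counter 0)) →
             Run n (19 + cost e) (fill b e) σ (λ τ → ∀ {j} → j < n → τ b j ≡ g j)
  run-fill {σ} b e g {b≢} ld h =
    rescale (≤-reflexive (*-identityʳ n))
      (conseq
        (run-for {X = 1} (λ i τ → ∀ {j} → i ≤ j → j < n → τ b j ≡ g j) {xb = xb}
          (λ {i} {τ} {v} inv {j} i≤j j<n → trans (cong (λ f → f j) (set-fresh {τ} b b≢)) (inv i≤j j<n))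
          (λ {i} {τ} fr i<n x≡ inv → run-set λ {j} i≤j j<n → step fr x≡ inv i≤j j<n)
          (num-vars σ ld) λ n≤j j<n → contradiction j<n (≤⇒≯ n≤j))
        λ _ inv → inv z≤n)
    where
    xb : T (fresh counter (set b at $ counter to e))
    xb = go b b≢
      where
      go : ∀ b → T (not ⌊ b ≟ counter ⌋) → T (not ⌊ counter ≟ b ⌋)
      go b t with counter ≟ b
      ... | yes refl = t
      ... | no _     = tt
    step : ∀ {i τ j} → Frame (fill b e) σ τ → τ counter 0 ≡ i → (∀ {j} → suc i ≤ j → j < n → τ b j ≡ g j) →
           i ≤ j → j < n → (τ [ b , τ counter 0 ↦ eval e τ ]) b j ≡ g j
    step {i} {τ} {j} fr refl inv i≤j j<n = case j ≟ i of λ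
      { (yes refl) → trans (set-hit τ b i (eval e τ)) (h fr)
      ; (no j≢i)   → trans (set-miss τ b (eval e τ) j≢i) (inv (≤∧≢⇒< i≤j (j≢i ∘ sym)) j<n) }

  -- Forward chaining, full or restricted to smaller closures.

  Enabled : (ℕ → ℕ) → ℕ → (Clause n → Set) → ℕ → Clause n → Set
  Enabled sz l E k C = (l ∸ sz k ≢ 0 → E C) × (E C → l ∸ sz k ≢ 0)

  run-testLiterals : ∀ {σ B e rest} {D : Set} → eval e σ ≡ ∣ B ∣ →
    At (σ input) (σ ptr 0) (map toℕ (elements B) ++ rest) →
    (σ ok 0 ≢ 0 → D) × (D → σ ok 0 ≢ 0) →
    Run (suc ∣ B ∣) (14 + cost e + 15) (for literal e testLiteral) σ λ τ →
      At (σ input) (τ ptr 0) rest ×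
      (τ ok 0 ≢ 0 → D × B ⊆ support (σ work)) × (D → B ⊆ support (σ work) → τ ok 0 ≢ 0)
  run-testLiterals {σ} {B} {e} {rest} {D} len rd (ok→ , →ok) =
    rescale (≤-reflexive (cong suc (trans (sum-const (elements B) 1) (trans (*-identityʳ _) (length-elements B)))))
      (conseq
        (run-for-list Inv (λ _ → 1) (λ {_} {τ} {v} i → i) step (elements B)
          (trans len (sym (length-elements B)))
          (rd , (λ z → ok→ z , λ x∈ → inj₂ (∈-filter⁺ (_∈? B) (∈-allFin _) x∈)) , (λ d _ → →ok d) ,
           λ x∈ → proj₂ (∈-filter⁻ (_∈? B) {xs = allFin n} x∈)))
        λ { _ (rd , a , b , _) → rd , (λ z → proj₁ (a z) , λ x∈ → case proj₂ (a z) x∈ of λ { (inj₁ y) → y }) , b })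
    where
    W = support (σ work)
    Inv : List (Fin n) → Store → Set
    Inv as τ = At (σ input) (τ ptr 0) (map toℕ as ++ rest) ×
               (τ ok 0 ≢ 0 → D × (∀ {x} → x ∈ B → x ∈ W ⊎ x ∈ˡ as)) ×
               (D → B ⊆ W → τ ok 0 ≢ 0) ×
               (∀ {x} → x ∈ˡ as → x ∈ B)
    step : ∀ a as {τ} → Frame (for literal e testLiteral) σ τ → τ literal 0 ≡ length as →
           Inv (a ∷ as) τ → 1 ≤ 1 × Run 1 _ testLiteral τ (Inv as)
    step a as {τ} fr _ ((a≡ , rd) , f , g , sub) = ≤-refl ,
      run-seq {R = λ τ′ → τ′ ptr 0 ≡ τ ptr 0 × (τ′ ok 0 ≢ 0 → D × (∀ {x} → x ∈ B → x ∈ W ⊎ x ∈ˡ as)) ×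
               (D → B ⊆ W → τ′ ok 0 ≢ 0)}
        (run-if
          (λ ≢0 → run-skip (refl , (λ z → proj₁ (f z) , λ x∈ → case proj₂ (f z) x∈ of λ
             { (inj₁ x∈W) → inj₁ x∈W
             ; (inj₂ (here refl)) → inj₁ (∈-support⁺ (subst (_≢ 0) cell ≢0))
             ; (inj₂ (there x∈as)) → inj₂ x∈as }) , g))
          (λ ≡0 → run-set (refl , (λ z → contradiction refl z) ,
             λ d B⊆W → contradiction (trans (sym cell) ≡0) (∈-support⁻ (B⊆W (sub (here refl)))))))
        λ { {τ′} fr′ (p , f′ , g′) → run-set (subst (λ k → At (σ input) k (map toℕ as ++ rest)) (cong suc (sym p)) rd , f′ , g′ , sub ∘ there) }
      where
      cell : τ work (τ input (τ ptr 0)) ≡ σ work (toℕ a)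
      cell = trans (cong (λ h → h (τ input (τ ptr 0))) (same fr work))
               (cong (σ work) (trans (cong (λ h → h (τ ptr 0)) (same fr input)) a≡))

  -- Within a pass, a clause is tested against what earlier ones have just added, so the result
  -- depends on their order. It is only sandwiched: it contains the heads of selected clauses with
  -- body in `S`, and lies in every closed set above `S`.
  record Passed (E : Clause n → Set) (S W : Subset n) : Set where
    field
      grows    : S ⊆ W
      fires    : ∀ {C} → C ∈ˡ Ψ → E C → body C ⊆ S → head C ∈ W
      confined : ∀ T → (∀ {C} → C ∈ˡ Ψ → E C → Sat C T) → S ⊆ T → W ⊆ T

  open Passed

  run-pass : ∀ σ {E} → Loaded σ → AllAt (Enabled (σ sizes) (σ lim 0) E) 0 Ψ →
             Run L 150 pass σ (λ τ → Passed E (support (σ work)) (support (τ work)))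
  run-pass σ {E} ld en = weaken (run-set⨾ (run-set⨾ (conseq
    (run-for-list′ Inv width (λ i → i) step Ψ (num-clauses σ ld)
      (input-clauses σ ld , en , id , id , (λ C∈ _ _ → inj₂ C∈) , λ T _ S⊆T → S⊆T))
    λ { _ (_ , _ , _ , grow , fire , conf) → record
      { grows = grow ; confined = conf
      ; fires = λ C∈ e B⊆ → case fire C∈ e B⊆ of λ { (inj₁ h∈) → h∈ } } })))
    where
    S = support (σ work)
    Inv : CNF n → Store → Set
    Inv Cs τ = At (σ input) (τ ptr 0) (concatMap encodeClause Cs) ×
               AllAt (Enabled (σ sizes) (σ lim 0) E) (τ idx 0) Cs ×
               (∀ {C} → C ∈ˡ Cs → C ∈ˡ Ψ) ×
               S ⊆ support (τ work) ×
               (∀ {C} → C ∈ˡ Ψ → E C → body C ⊆ S → head C ∈ support (τ work) ⊎ C ∈ˡ Cs) ×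
               (∀ T → (∀ {C} → C ∈ˡ Ψ → E C → Sat C T) → S ⊆ T → support (τ work) ⊆ T)
    σ₀ = (σ [ ptr , 0 ↦ 2 ]) [ idx , 0 ↦ 0 ]
    step : ∀ C Cs {τ} → Frame (for clauses numClauses testClause) σ₀ τ → τ clauses 0 ≡ length Cs →
           Inv (C ∷ Cs) τ → 1 ≤ width C × Run (width C) _ testClause τ (Inv Cs)
    step C@(clause B v _) Cs {τ} fr _ ((v≡ , len≡ , rd) , ((ok→ , →ok) , en) , sub , grow , fire , conf) =
      s≤s z≤n ,
      run-set⨾ (run-set⨾ (run-set⨾ (run-set⨾
        (run-seq (run-testLiterals {B = B} {rest = concatMap encodeClause Cs} {D = E C}
                    (trans (cong (λ f → f (suc (τ ptr 0))) in≡) len≡)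
                    (subst (λ f → At f _ (map toℕ (elements B) ++ concatMap encodeClause Cs)) (sym in≡) rd)
                    (subst (λ k → (k ≢ 0 → E C) × (E C → k ≢ 0)) (sym ok≡) (ok→ , →ok)))
          λ { {τ′} fr′ (rd′ , ok→′ , →ok′) →
            let hd≡ = trans (at-zero (same fr′ hd)) (trans (cong (λ f → f (τ ptr 0)) in≡) v≡)
                wk≡ = cong support (same fr′ work)
                rd″ = subst (λ f → At f (τ′ ptr 0) (concatMap encodeClause Cs)) in≡ rd′
                en″ = subst (λ k → AllAt (Enabled (σ sizes) (σ lim 0) E) k Cs) (sym (at-zero (same fr′ idx))) en
            in run-if
              (λ ok≢0 →
                let e , B⊆ = ok→′ ok≢0
                    ins = trans (support-insert {a = τ′ work} v hd≡) (cong (_∪ ⁅ v ⁆) wk≡)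
                in run-set (rd″ , en″ , sub ∘ there ,
                     (λ x∈ → subst (_ ∈_) (sym ins) (x∈p∪q⁺ (inj₁ (grow x∈)))) ,
                     (λ C∈ e B⊆ → case fire C∈ e B⊆ of λ
                       { (inj₁ h∈) → inj₁ (subst (_ ∈_) (sym ins) (x∈p∪q⁺ (inj₁ h∈)))
                       ; (inj₂ (here refl)) → inj₁ (subst (_ ∈_) (sym ins) (x∈p∪q⁺ (inj₂ (x∈⁅x⁆ v))))
                       ; (inj₂ (there C∈)) → inj₂ C∈ }) ,
                     λ T m S⊆T x∈ → ∪⁅⁆-least (conf T m S⊆T)
                       (m (sub (here refl)) e λ y∈ → conf T m S⊆T (B⊆ y∈))
                       (subst (_ ∈_) ins x∈)))
              (λ ok≡0 → run-skip (rd″ , en″ , sub ∘ there ,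
                (λ x∈ → subst (_ ∈_) (sym wk≡) (grow x∈)) ,
                (λ C∈ e B⊆ → case fire C∈ e B⊆ of λ
                       { (inj₁ h∈) → inj₁ (subst (_ ∈_) (sym wk≡) h∈)
                       ; (inj₂ (here refl)) → contradiction ok≡0 (→ok′ e (λ x∈ → grow (B⊆ x∈)))
                       ; (inj₂ (there C∈)) → inj₂ C∈ }) ,
                λ T m S⊆T x∈ → conf T m S⊆T (subst (_ ∈_) wk≡ x∈))) }))))
      where
      in≡ : τ input ≡ σ input
      in≡ = same fr input
      ok≡ : τ lim 0 ∸ τ sizes (τ idx 0) ≡ σ lim 0 ∸ σ sizes (τ idx 0)
      ok≡ = cong₂ _∸_ (at-zero (same fr lim)) (cong (λ f → f (τ idx 0)) (same fr sizes))

  -- A pass that adds nothing certifies closedness, and any other adds an element. After n passes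
  -- the set is therefore closed or has n elements; in the latter case it is everything, which
  -- satisfies all clauses.
  run-close : ∀ σ {E} → Loaded σ → AllAt (Enabled (σ sizes) (σ lim 0) E) 0 Ψ →
              Run (n * L) 200 close σ (λ τ → Closure E Ψ (support (σ work)) (support (τ work)))
  run-close σ {E} ld en = weaken (conseq
    (run-for Inv (λ i → i) step (num-vars σ ld)
      (id , (λ T _ S⊆T → S⊆T) , inj₂ (m≤n+m n _)))
    λ { {τ} _ (grow , conf , fin) → record
      { extends = grow ; least = conf
      ; closed = case fin of λ
        { (inj₁ cl) → cl
        ; (inj₂ full) → λ _ _ _ → subst (_ ∈_) (sym (∣p∣≡n⇒p≡⊤ (≤-antisym (∣p∣≤n (support (τ work)))
                          (≤-trans full (≤-reflexive (+-identityʳ _)))))) ∈⊤ } } })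
    where
    S = support (σ work)
    Closed : Subset n → Set
    Closed W = ∀ {C} → C ∈ˡ Ψ → E C → Sat C W
    Inv : ℕ → Store → Set
    Inv i τ = S ⊆ support (τ work) ×
              (∀ T → Closed T → S ⊆ T → support (τ work) ⊆ T) ×
              (Closed (support (τ work)) ⊎ n ≤ ∣ support {n} (τ work) ∣ + i)
    step : ∀ {i τ} → Frame close σ τ → i < n → τ rounds 0 ≡ i → Inv (suc i) τ → Run L _ pass τ (Inv i)
    step {i} {τ} fr _ _ (grow , conf , prog) = conseq
      (run-pass τ {E} (trans (same fr input) ld)
        (subst₂ (λ f k → AllAt (Enabled f k E) 0 Ψ) (sym (same fr sizes)) (sym (at-zero (same fr lim))) en))
      λ {τ′} _ p →
        (λ x∈ → grows p (grow x∈)) ,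
        (λ T cl S⊆T → confined p T cl (conf T cl S⊆T)) ,
        progress p prog
      where
      progress : ∀ {W′} → Passed E (support (τ work)) W′ →
                 Closed (support (τ work)) ⊎ n ≤ ∣ support {n} (τ work) ∣ + suc i →
                 Closed W′ ⊎ n ≤ ∣ W′ ∣ + i
      progress {W′} p prog with W′ ⊆? support (τ work)
      ... | yes W′⊆ = inj₁ λ C∈ e B⊆ → fires p C∈ e λ x∈ → W′⊆ (B⊆ x∈)
      ... | no W′⊈ with prog
      ...   | inj₁ cl = contradiction (λ {x} → confined p _ cl id {x}) W′⊈
      ...   | inj₂ n≤ = inj₂ (≤-trans n≤ (≤-trans (≤-reflexive (+-suc _ i)) (+-monoˡ-≤ i (⊈⇒< (grows p) W′⊈))))

  -- Copying, reading, counting and writing sets.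

  run-copy : ∀ σ a b → {b≢ : T (not ⌊ b ≟ counter ⌋)} {a≢ : T (fresh a (copy a b))} → Loaded σ →
             Run n 22 (copy a b) σ (λ τ → support {n} (τ b) ≡ support (σ a))
  run-copy σ a b {b≢} {a≢} ld = conseq
    (run-fill b (a at $ counter) (σ a) {b≢} ld λ {τ} fr → cong (λ f → f (τ counter 0)) (same fr a {a≢}))
    λ _ → support-cong

  run-load : ∀ σ C {rest} → Loaded σ → At (σ input) (σ pos 0) (encodeClause C ++ rest) →
             Run n 120 load σ (λ τ → support (τ work) ≡ body C × At (σ input) (τ pos 0) rest)
  run-load σ C@(clause B v _) {rest} ld (_ , len≡ , rd) = weaken (run-seq
    (run-fill work (lit 0) (λ _ → 0) ld (λ _ → refl))
    λ {τ} fr z →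
      let in≡ = same fr input
          pos≡ = at-zero (same fr pos)
          e = input at ($ pos ⊖ lit 1)
          b = set work at (input at $ pos) to lit 1 ⨾ pos ≔ lit 1 ⊕ $ pos
          Inv : List (Fin n) → Store → Set
          Inv = λ as ρ → At (σ input) (ρ pos 0) (map toℕ as ++ rest) ×
                  (∀ {x} → x ∈ support (ρ work) → x ∈ B) ×
                  (∀ {x} → x ∈ B → x ∈ support (ρ work) ⊎ x ∈ˡ as) ×
                  (∀ {x} → x ∈ˡ as → x ∈ B)
          σ₁ = τ [ pos , 0 ↦ 2 + τ pos 0 ]
      in run-set⨾ (conseq (unsuc (rescale (s≤s (≤-trans (≤-reflexive
            (trans (sum-const (elements B) 1) (trans (*-identityʳ _) (length-elements B)))) (∣p∣≤n B)))
          (run-for-list Inv (λ _ → 1) (λ i → i)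
            (λ a as {ρ} fr′ _ (( a≡ , rd′) , f , g , h) → ≤-refl ,
              let ins = support-insert {a = ρ work} {k = 0} a (trans (cong (λ f → f (ρ pos 0)) (trans (same fr′ input) in≡)) a≡)
              in run-set⨾ (run-set (rd′ ,
                (λ x∈ → ∪⁅⁆-least f (h (here refl)) (subst (_ ∈_) ins x∈)) ,
                (λ x∈ → case g x∈ of λ
                  { (inj₁ x∈W) → inj₁ (subst (_ ∈_) (sym ins) (x∈p∪q⁺ (inj₁ x∈W)))
                  ; (inj₂ (here refl)) → inj₁ (subst (_ ∈_) (sym ins) (x∈p∪q⁺ (inj₂ (x∈⁅x⁆ a))))
                  ; (inj₂ (there x∈as)) → inj₂ x∈as }) ,
                h ∘ there)))
            (elements B)
            (trans (cong₂ (λ f k → f (suc k)) in≡ pos≡) (trans len≡ (sym (length-elements B))))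
            (subst (λ k → At (σ input) (2 + k) (map toℕ (elements B) ++ rest)) (sym pos≡) rd ,
             (λ x∈ → contradiction (subst (_ ∈_) (support-zero z) x∈) ∉⊥) ,
             (λ x∈ → inj₂ (∈-filter⁺ (_∈? B) (∈-allFin _) x∈)) ,
             λ x∈ → proj₂ (∈-filter⁻ (_∈? B) {xs = allFin n} x∈)))))
        λ _ (rd′ , f , g , _) → ⊆-antisym f (λ x∈ → case g x∈ of λ { (inj₁ x∈W) → x∈W }) , rd′))

  run-tally : ∀ σ → Loaded σ → Run n 60 tallyWork σ (λ τ → τ tally 0 ≡ ∣ support {n} (σ work) ∣)
  run-tally σ ld = weaken (run-set⨾ (conseq (rescale (≤-reflexive (*-identityʳ n))
      (run-for {X = 1} (λ i τ → τ tally 0 + count (σ work) i ≡ ∣ support {n} (σ work) ∣) (λ i → i)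
        (λ { {i} {τ} fr _ refl inv →
          let wk≡ = cong (λ f → f (τ counter 0)) (same fr work)
          in run-if
            (λ ≢0 → run-set (trans (sym (+-suc (τ tally 0) _))
                (trans (cong (λ b → τ tally 0 + (b + count (σ work) i)) (sym (bit-suc (subst (_≢ 0) wk≡ ≢0)))) inv)))
            (λ ≡0 → run-skip (trans (cong (λ k → τ tally 0 + (bit k + count (σ work) i)) (trans (sym ≡0) wk≡)) inv)) })
        (num-vars σ ld) (sym (∣support∣ n (σ work)))))
    λ _ e → trans (sym (+-identityʳ _)) e))

  run-code : ∀ σ → Loaded σ → Run n 60 codeWork σ (λ τ → τ code 0 ≡ key n (σ work))
  run-code σ ld = weaken (run-set⨾ (rescale (≤-reflexive (*-identityʳ n))
      (run-for {X = 1} (λ i τ → horner (σ work) i (τ code 0) ≡ key n (σ work)) (λ i → i)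
        (λ { {i} {τ} fr _ refl inv →
          let wk≡ = cong (λ f → f (τ counter 0)) (same fr work)
              cc = τ code 0 + τ code 0
          in run-if
            (λ ≢0 → run-set (trans (cong (horner (σ work) i) (trans (+-comm 1 cc)
                (cong (cc +_) (sym (bit-suc (subst (_≢ 0) wk≡ ≢0)))))) inv))
            (λ ≡0 → run-set (trans (cong (horner (σ work) i) (trans (sym (+-identityʳ cc))
                (cong (λ k → cc + bit k) (trans (sym ≡0) wk≡)))) inv)) })
        (num-vars σ ld) refl)))

  run-emit : ∀ σ {xs} → Loaded σ → Written (σ output) (σ outPtr 0) xs →
             σ tally 0 ≡ ∣ support {n} (σ work) ∣ →
             Run n 120 emit σ (λ τ → Written (τ output) (τ outPtr 0) (xs ++ encodeSet (support {n} (σ work))))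
  run-emit σ {xs} ld wr cnt = weaken (run-set⨾ (run-set⨾ (run-set⨾ (conseq
      (rescale (≤-reflexive (trans (sum-const (allFin n) 1) (trans (*-identityʳ _) (length-tabulate (id {A = Fin n})))))
        (run-for-list′ Inv (λ _ → 1) (λ i → i) step (allFin n) ⦃ nz ⦄
          (trans (num-vars σ ld) (sym (length-tabulate (id {A = Fin n}))))
          (_ , subst (λ k → Written _ _ (xs ++ [ k ])) cnt (written-push xs wr) ,
           trans (++-assoc xs [ _ ] _) refl , consecutive-allFin n)))
      λ { {τ} _ (ys , wr′ , eq , _) → subst (Written (τ output) (τ outPtr 0)) (trans (sym (++-identityʳ ys)) eq) wr′ }))))
    where
    S = support {n} (σ work)
    nz : NonZero (sum (map (λ _ → 1) (allFin n)))
    nz = subst NonZero (sym (trans (sum-const (allFin n) 1) (trans (*-identityʳ _) (length-tabulate (id {A = Fin n}))))) it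
    Inv : List (Fin n) → Store → Set
    Inv as τ = ∃[ ys ] Written (τ output) (τ outPtr 0) ys ×
               ys ++ map toℕ (filter (_∈? S) as) ≡ xs ++ encodeSet S ×
               Consecutive (τ idx 0) as
    σ₀ = ((σ [ output , σ outPtr 0 ↦ σ tally 0 ]) [ outPtr , 0 ↦ suc (σ outPtr 0) ]) [ idx , 0 ↦ 0 ]
    b = ifte (work at $ idx) (set output at $ outPtr to $ idx ⨾ outPtr ≔ lit 1 ⊕ $ outPtr) skip ⨾ idx ≔ lit 1 ⊕ $ idx
    step : ∀ a as {τ} → Frame (for counter numVars b) σ₀ τ → τ counter 0 ≡ length as →
           Inv (a ∷ as) τ → 1 ≤ 1 × Run 1 _ b τ (Inv as)
    step a as {τ} fr _ (ys , wr′ , eq , a≡ , con) = ≤-refl ,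
      run-seq {R = λ ρ → ρ idx 0 ≡ τ idx 0 × ∃[ zs ] Written (ρ output) (ρ outPtr 0) zs ×
                         zs ++ map toℕ (filter (_∈? S) as) ≡ xs ++ encodeSet S}
        (run-if
          (λ ≢0 → run-set⨾ (run-set (refl , ys ++ [ τ idx 0 ] , written-push ys wr′ ,
            trans (++-assoc ys [ τ idx 0 ] _) (trans (cong (λ k → ys ++ k ∷ map toℕ (filter (_∈? S) as)) (sym a≡))
              (trans (cong (λ l → ys ++ map toℕ l) (sym (filter-accept (_∈? S) (∈-support⁺ (subst (_≢ 0) cell ≢0))))) eq)))))
          (λ ≡0 → run-skip (refl , ys , wr′ , trans (cong (λ l → ys ++ map toℕ l)
            (sym (filter-reject (_∈? S) (λ a∈ → ∈-support⁻ a∈ (trans (sym cell) ≡0))))) eq)))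
        λ { {ρ} _ (i≡ , zs , wr″ , eq′) → run-set (zs , wr″ , eq′ , subst (λ k → Consecutive (suc k) as) (sym i≡) con) }
      where
      cell : τ work (τ idx 0) ≡ σ work (toℕ a)
      cell = trans (cong (λ f → f (τ idx 0)) (same fr work)) (cong (σ work) (sym a≡))

  size≤n : ∀ C → size C ≤ n
  size≤n C = ∣p∣≤n (F (body C))

  enabled-always : ∀ {sz} Cs c → (∀ j → sz j ≤ n) → AllAt (Enabled sz (suc n) Always) c Cs
  enabled-always []       c h = tt
  enabled-always (C ∷ Cs) c h = ((λ _ → tt) , (λ _ → m>n⇒m∸n≢0 (s≤s (h c)))) , enabled-always Cs (suc c) h

  enabled-smaller : ∀ {sz} s Cs c → At sz c (map size Cs) → AllAt (Enabled sz s (Smaller s)) c Cs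
  enabled-smaller s []       c _       = tt
  enabled-smaller s (C ∷ Cs) c (e , h) =
    ((λ ≢0 → subst (_< s) e (≰⇒> (≢0 ∘ m≤n⇒m∸n≡0))) , (λ lt → m>n⇒m∸n≢0 (subst (_< s) (sym e) lt))) ,
    enabled-smaller s Cs (suc c) h

  record Unlimited (sz : ℕ → ℕ) (l : ℕ) : Set where
    constructor unlimited
    field
      lim≡  : l ≡ suc n
      sizes≤ : ∀ j → sz j ≤ n

  run-F : ∀ σ → Loaded σ → Unlimited (σ sizes) (σ lim 0) →
          Run (n * L) 200 close σ (λ τ → support (τ work) ≡ F (support (σ work)))
  run-F σ ld (unlimited l≡ sz≤) = conseq
    (run-close σ ld (subst (λ k → AllAt (Enabled (σ sizes) k Always) 0 Ψ) (sym l≡) (enabled-always Ψ 0 sz≤)))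
    λ _ → closure≡F

  n⁴L : ℕ
  n⁴L = n * (n * (n * (n * L)))

  n≤nL : n ≤ n * L
  n≤nL = m≤m*n n L

  nL≤n³L : n * L ≤ n * (n * (n * L))
  nL≤n³L = ≤-trans (m≤n*m (n * L) n) (m≤n*m (n * (n * L)) n)

  n≤n³L : n ≤ n * (n * (n * L))
  n≤n³L = ≤-trans n≤nL nL≤n³L

  n≤n⁴L : n ≤ n⁴L
  n≤n⁴L = ≤-trans n≤n³L (m≤n*m (n * (n * (n * L))) n)

  nL≤n⁴L : n * L ≤ n⁴L
  nL≤n⁴L = ≤-trans nL≤n³L (m≤n*m (n * (n * (n * L))) n)

  unlimited-frame : ∀ {p σ τ} {f : T (fresh sizes p)} {g : T (fresh lim p)} → Frame p σ τ →
                    Unlimited (σ sizes) (σ lim 0) → Unlimited (τ sizes) (τ lim 0)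
  unlimited-frame {f = f} {g} fr u =
    subst₂ Unlimited (sym (same fr sizes {f})) (sym (at-zero (same fr lim {g}))) u

  loaded-frame : ∀ {p σ τ} {f : T (fresh input p)} → Frame p σ τ → Loaded σ → Loaded τ
  loaded-frame {f = f} fr ld = trans (same fr input {f}) ld

  -- The table of closure sizes.

  Measured : CNF n → (ℕ → ℕ) → Set
  Measured Cs sz = At sz 0 (map size Cs) × (∀ j → sz j ≤ n)

  measured-push : ∀ {sz} Cs C → Measured Cs sz → Measured (Cs ++ [ C ]) (update sz (length Cs) (size C))
  measured-push {sz} Cs C (h , b) =
    subst (At _ 0) (sym (map-++ size Cs [ C ])) (at-push {q = 0} {map size Cs} h (sym (length-map size Cs))) ,
    λ j → case j ≟ length Cs of λ
      { (yes refl) → ≤-trans (≤-reflexive (update-hit sz (length Cs) (size C))) (size≤n C)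
      ; (no j≢)    → ≤-trans (≤-reflexive (update-miss sz (size C) j≢)) (b j) }

  -- A scale of n * L per clause suffices for this work; the coarser one is that of `generate`, so
  -- that the two runs can be composed.
  run-measureAll : ∀ σ → Loaded σ → (∀ j → σ sizes j ≡ 0) →
    Run (suc (sum (map (λ _ → n⁴L) Ψ))) 600 measureAll σ (λ τ → Measured Ψ (τ sizes))
  run-measureAll σ ld sz0 = weaken (run-set⨾ (run-set⨾ (run-set⨾ (conseq
    (run-for-list Inv (λ _ → n⁴L) (λ i → i) step Ψ (num-clauses σ ld)
      ([] , refl , input-clauses σ ld , (tt , λ j → ≤-trans (≤-reflexive (sz0 j)) z≤n) , refl))
    λ { {τ} _ (pre , eq , _ , ms , _) → subst (λ Cs → Measured Cs (τ sizes)) (trans (sym (++-identityʳ pre)) eq) ms }))))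
    where
    Inv : CNF n → Store → Set
    Inv Cs τ = ∃[ pre ] pre ++ Cs ≡ Ψ × At (σ input) (τ pos 0) (concatMap encodeClause Cs) ×
               Measured pre (τ sizes) × τ cidx 0 ≡ length pre
    σ₀ = ((σ [ pos , 0 ↦ 2 ]) [ cidx , 0 ↦ 0 ]) [ lim , 0 ↦ suc (σ input 0) ]
    step : ∀ C Cs {τ} → Frame (for outer numClauses measure) σ₀ τ → τ outer 0 ≡ length Cs →
           Inv (C ∷ Cs) τ → 1 ≤ n⁴L × Run n⁴L _ measure τ (Inv Cs)
    step C Cs {τ} fr _ (pre , eq , rd , ms , c≡) = >-nonZero⁻¹ n⁴L ,
      rescale nL≤n⁴L (run-seq
        (rescale n≤nL (run-load τ C (loaded-frame fr ld)
          (subst (λ f → At f (τ pos 0) (encodeClause C ++ concatMap encodeClause Cs)) (sym (same fr input)) rd)))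
        λ {τ₁} f₁ (w≡ , rd₁) →
          let ld₁ = loaded-frame f₁ (loaded-frame fr ld)
              lim≡ = trans (at-zero (trans (same f₁ lim) (same fr lim))) (cong suc (num-vars σ ld))
          in run-seq (run-F τ₁ ld₁ (unlimited lim≡ (λ j → ≤-trans (≤-reflexive (cong (λ f → f j) (same f₁ sizes))) (proj₂ ms j))))
        λ {τ₂} f₂ F≡ → run-seq (rescale n≤nL (run-tally τ₂ (loaded-frame f₂ ld₁)))
        λ {τ₃} f₃ t≡ →
          let s≡ = trans t≡ (cong ∣_∣ (trans F≡ (cong F w≡)))
              sz≡ = trans (same f₃ sizes) (trans (same f₂ sizes) (same f₁ sizes))
              ci≡ = at-zero (trans (same f₃ cidx) (trans (same f₂ cidx) (same f₁ cidx)))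
              pos≡ = at-zero (trans (same f₃ pos) (same f₂ pos))
              in≡ = same fr input
          in run-set⨾ (run-set (pre ++ [ C ] , trans (++-assoc pre [ C ] Cs) eq ,
               subst₂ (λ f k → At f k (concatMap encodeClause Cs)) in≡ (sym pos≡) rd₁ ,
               subst₂ (λ c s → Measured (pre ++ [ C ]) (update (τ₃ sizes) c s)) (sym (trans ci≡ c≡)) (sym s≡)
                 (subst (λ f → Measured (pre ++ [ C ]) (update f (length pre) (size C))) (sym sz≡) (measured-push pre C ms)) ,
               trans (cong suc (trans ci≡ c≡)) (trans (+-comm 1 (length pre)) (sym (length-++ pre))))))

  -- The search for an element that completes an edge.

  -- Counters descend, so the elements already examined form an upper segment of `Fin n`; each
  -- iteration adds the next lower one.
  extend-down : ∀ (P : Fin n → Set) {i} (i<n : i < n) → (∀ {x} → suc i ≤ toℕ x → P x) → P (fromℕ< i<n) →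
                ∀ {x} → i ≤ toℕ x → P x
  extend-down P {i} i<n above at-i {x} i≤x with i ≟ toℕ x
  ... | yes i≡x = subst P (toℕ-injective (trans (toℕ-fromℕ< i<n) i≡x)) at-i
  ... | no  i≢x = above (≤∧≢⇒< i≤x i≢x)

  Redundant : Subset n → Fin n → Fin n → Set
  Redundant T u w = w ∈ F ((T - w) ∪ ⁅ u ⁆)

  run-check : ∀ σ u → Loaded σ → Unlimited (σ sizes) (σ lim 0) → σ cand 0 ≡ toℕ u →
    let T = support (σ current) in
    Run (n * (n * L)) 400 check σ λ τ →
      (τ good 0 ≢ 0 → ∀ {w} → w ∈ T → Redundant T u w) ×
      (τ good 0 ≡ 0 → ∃[ w ] w ∈ T × ¬ Redundant T u w)
  run-check σ u ld un u≡ = weaken (run-set⨾ (conseq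
    (run-for Inv (λ i → i) step (num-vars σ ld)
      ((λ _ {w} n≤w → contradiction (toℕ<n w) (≤⇒≯ n≤w)) , λ ()))
    λ _ (all , none) → (λ z → all z z≤n) , none))
    where
    T₀ = support (σ current)
    Inv : ℕ → Store → Set
    Inv i τ = (τ good 0 ≢ 0 → ∀ {w} → i ≤ toℕ w → w ∈ T₀ → Redundant T₀ u w) ×
              (τ good 0 ≡ 0 → ∃[ w ] w ∈ T₀ × ¬ Redundant T₀ u w)
    σ₀ = σ [ good , 0 ↦ 1 ]
    step : ∀ {i τ} → Frame (for del numVars probe) σ₀ τ → i < n → τ del 0 ≡ i → Inv (suc i) τ →
           Run (n * L) _ probe τ (Inv i)
    step {i} {τ} fr i<n d≡ (all , none) = run-if
      (λ ≢0 → run-seq (rescale n≤nL (run-copy τ current work ldτ))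
        λ {τ₁} f₁ c≡ → run-set⨾ (run-set⨾ (
          let w≡₁ = trans (at-zero (same f₁ del)) w≡
              u≡₁ = trans (at-zero (trans (same f₁ cand) (same fr cand))) u≡
              work≡ = trans (support-insert {k = 0} u u≡₁) (cong (_∪ ⁅ u ⁆)
                        (trans (support-delete {a = τ₁ work} w w≡₁) (cong (_- w) (trans c≡ (cong support (same fr current))))))
          in run-seq (run-F _ (loaded-frame f₁ ldτ) (unlimited-frame f₁ (unlimited-frame fr un)))
        λ {τ₂} f₂ F≡ →
          let F≡′ = trans F≡ (cong F work≡)
              g≡ = at-zero (trans (same f₂ good) (same f₁ good))
              d₂ = trans (at-zero (same f₂ del)) w≡₁
          in run-if
            (λ ≢0 → run-skip
              ((λ z → extend-down _ i<n (λ {x} → all (subst (_≢ 0) g≡ z) {x})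
                  (λ _ → subst (w ∈_) F≡′ (∈-support⁺ (subst (λ k → τ₂ work k ≢ 0) d₂ ≢0)))) ,
               λ z → none (trans (sym g≡) z)))
            (λ ≡0 → run-set
              ((λ z → contradiction refl z) ,
               λ _ → w , subst (w ∈_) (cong support (same fr current)) (∈-support⁺ (subst (λ k → τ current k ≢ 0) w≡ ≢0)) ,
                 λ w∈ → ∈-support⁻ (subst (w ∈_) (sym F≡′) w∈) (subst (λ k → τ₂ work k ≡ 0) d₂ ≡0))))))
      λ ≡0 → run-skip ((λ z → extend-down _ i<n (λ {x} → all z {x})
          λ w∈ → contradiction (subst (λ k → τ current k ≡ 0) w≡ ≡0)
                   (∈-support⁻ (subst (w ∈_) (sym (cong support (same fr current))) w∈))) , none)
      where
      w = fromℕ< i<n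
      w≡ : τ del 0 ≡ toℕ w
      w≡ = trans d≡ (sym (toℕ-fromℕ< i<n))
      ldτ : Loaded τ
      ldτ = loaded-frame fr ld

  Suitable : Subset n → Subset n → Fin n → Set
  Suitable Z T u = u ∈ Z × u ∉ T × (∀ {w} → w ∈ T → Redundant T u w)

  -- `missing` carries a witness of its own because `Stuck Z T` holds vacuously once `T` contains
  -- `Z`; failure may be declared only when an element is truly absent.
  run-search : ∀ σ → Loaded σ → Unlimited (σ sizes) (σ lim 0) →
    let Z = support (σ goal) ; T = support (σ current) in
    Run (n * (n * (n * L))) 600 search σ λ τ →
      (τ missing 0 ≡ 0 → Z ⊆ T) ×
      (τ missing 0 ≢ 0 → ∃[ u ] u ∈ Z × u ∉ T) ×
      (τ found 0 ≡ 0 → Stuck Z T) ×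
      (τ found 0 ≢ 0 → ∃[ u ] τ found 0 ≡ suc (toℕ u) × Suitable Z T u)
  run-search σ ld un = weaken (run-set⨾ (run-set⨾ (conseq
    (run-for Inv (λ i → i) step (num-vars σ ld)
      ((λ _ {u} n≤u → contradiction (toℕ<n u) (≤⇒≯ n≤u)) , (λ z → contradiction refl z) ,
       (λ _ {u} n≤u → contradiction (toℕ<n u) (≤⇒≯ n≤u)) , (λ z → contradiction refl z)))
    λ _ (a , b , c , d) → (λ z → a z z≤n) , b , (λ z → c z z≤n) , d)))
    where
    Z T₀ : Subset n
    Z = support (σ goal)
    T₀ = support (σ current)
    Inv : ℕ → Store → Set
    Inv i τ = (τ missing 0 ≡ 0 → ∀ {u} → i ≤ toℕ u → u ∈ Z → u ∈ T₀) ×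
              (τ missing 0 ≢ 0 → ∃[ u ] u ∈ Z × u ∉ T₀) ×
              (τ found 0 ≡ 0 → ∀ {u} → i ≤ toℕ u → u ∈ Z → u ∉ T₀ → ∃[ w ] w ∈ T₀ × ¬ Redundant T₀ u w) ×
              (τ found 0 ≢ 0 → ∃[ u ] τ found 0 ≡ suc (toℕ u) × Suitable Z T₀ u)
    σ₀ = (σ [ missing , 0 ↦ 0 ]) [ found , 0 ↦ 0 ]
    step : ∀ {i τ} → Frame (for cand numVars candidate) σ₀ τ → i < n → τ cand 0 ≡ i → Inv (suc i) τ →
           Run (n * (n * L)) _ candidate τ (Inv i)
    step {i} {τ} fr i<n c≡ (sub , miss , stuck , fnd) = run-if
      (λ z≢0 → run-if
        (λ t≢0 → run-skip ((λ z → extend-down _ i<n (λ {x} → sub z {x}) λ _ → in-T t≢0) , miss ,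
                           (λ z → extend-down _ i<n (λ {x} → stuck z {x}) λ _ u∉ → contradiction (in-T t≢0) u∉) , fnd))
        (λ t≡0 → run-set⨾ (run-seq (run-check (τ [ missing , 0 ↦ 1 ]) u (loaded-frame fr ld) (unlimited-frame fr un) u≡)
          λ {τ₁} f₁ (ok→ , ok→′) →
            let m≢0 = λ e → case trans (sym (at-zero (same f₁ missing))) e of λ ()
                f≡  = at-zero (same f₁ found)
                u∈Z = in-Z z≢0
                u∉T = λ u∈ → ∈-support⁻ (subst (u ∈_) (sym T≡) u∈) (subst (λ k → τ current k ≡ 0) u≡ t≡0)
                miss′ = λ _ → u , u∈Z , u∉T
            in run-if
              (λ g≢0 → run-set ((λ z → contradiction z m≢0) , miss′ , (λ ()) ,
                 λ _ → u , cong suc (trans (at-zero (same f₁ cand)) u≡) , u∈Z , u∉T ,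
                   λ {w} w∈ → subst (λ S → Redundant S u w) T≡ (ok→ g≢0 (subst (w ∈_) (sym T≡) w∈))))
              (λ g≡0 → run-skip ((λ z → contradiction z m≢0) , miss′ ,
                 (λ z → extend-down _ i<n (λ {x} → stuck (trans (sym f≡) z) {x})
                    λ _ _ → subst (λ S → ∃[ w ] w ∈ S × ¬ Redundant S u w) T≡ (ok→′ g≡0)) ,
                 λ z → case fnd (subst (_≢ 0) f≡ z) of λ (u′ , e , s) → u′ , trans f≡ e , s)))))
      λ z≡0 →
        let u∉Z = λ u∈ → ∈-support⁻ (subst (u ∈_) (sym (cong support (same fr goal))) u∈) (subst (λ k → τ goal k ≡ 0) u≡ z≡0)
        in run-skip ((λ z → extend-down _ i<n (λ {x} → sub z {x}) λ u∈ → contradiction u∈ u∉Z) , miss ,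
                     (λ z → extend-down _ i<n (λ {x} → stuck z {x}) λ u∈ _ → contradiction u∈ u∉Z) , fnd)
      where
      u = fromℕ< i<n
      u≡ : τ cand 0 ≡ toℕ u
      u≡ = trans c≡ (sym (toℕ-fromℕ< i<n))
      T≡ : support (τ current) ≡ T₀
      T≡ = cong support (same fr current)
      in-T : τ current (τ cand 0) ≢ 0 → u ∈ T₀
      in-T ≢0 = subst (u ∈_) T≡ (∈-support⁺ (subst (λ k → τ current k ≢ 0) u≡ ≢0))
      in-Z : τ goal (τ cand 0) ≢ 0 → u ∈ Z
      in-Z ≢0 = subst (u ∈_) (cong support (same fr goal)) (∈-support⁺ (subst (λ k → τ goal k ≢ 0) u≡ ≢0))

  -- The list of edges found so far.

  record OutputState (es : List (Subset n)) (out sn : ℕ → ℕ) (p k : ℕ) : Set where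
    field
      written : Written out p (concatMap encodeSet es)
      counted : k ≡ length es
      seen⁻   : ∀ a → sn (key n a) ≢ 0 → support a ∈ˡ es
      seen⁺   : ∀ a → support a ∈ˡ es → sn (key n a) ≢ 0
      unique  : Unique es
      sound   : All Good es

  open OutputState

  Output : List (Subset n) → Store → Set
  Output es σ = OutputState es (σ output) (σ seen) (σ outPtr 0) (σ edgeCount 0)

  output-frame : ∀ {es p σ τ} {f : T (fresh output p)} {g : T (fresh seen p)} {h : T (fresh outPtr p)}
                 {k : T (fresh edgeCount p)} → Frame p σ τ → Output es σ → Output es τ
  output-frame {es} {σ = σ} {τ} {f} {g} {h} {k} fr o
    rewrite same fr output {f} | same fr seen {g} | same fr outPtr {h} | same fr edgeCount {k} = o

  output-push : ∀ {es out sn p k out′ p′} a → OutputState es out sn p k → support a ∉ˡ es → Good (support a) →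
                Written out′ p′ (concatMap encodeSet es ++ encodeSet (support {n} a)) →
                OutputState (es ++ [ support a ]) out′ (update sn (key n a) 1) p′ (suc k)
  output-push {es} {sn = sn} {out′ = out′} {p′} a o new good wr = record
    { written = subst (Written out′ p′) (sym (trans (concatMap-++ encodeSet es [ support a ])
                  (cong (concatMap encodeSet es ++_) (++-identityʳ _)))) wr
    ; counted = trans (cong suc (counted o)) (trans (+-comm 1 (length es)) (sym (length-++ es)))
    ; seen⁻ = λ b ≢0 → case key n b ≟ key n a of λ
        { (yes e) → ∈-++⁺ʳ es (here (key-injective e))
        ; (no e)  → ∈-++⁺ˡ (seen⁻ o b (subst (_≢ 0) (update-miss sn 1 e) ≢0)) }
    ; seen⁺ = λ b b∈ e → case key n b ≟ key n a of λ
        { (yes e′) → case trans (sym (trans (cong (update sn (key n a) 1) e′) (update-hit sn (key n a) 1))) e of λ ()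
        ; (no e′)  → case ∈-++⁻ es b∈ of λ
            { (inj₁ b∈es) → seen⁺ o b b∈es (trans (sym (update-miss sn 1 e′)) e)
            ; (inj₂ (here eq)) → e′ (key-cong eq) } }
    ; unique = Unique-++ (unique o) ([] ∷ []) λ { (b∈ , here refl) → new b∈ }
    ; sound = All-++ (sound o) (good ∷ [])
    }

  run-addEdge : ∀ σ u {es} → Loaded σ → σ found 0 ≡ suc (toℕ u) → Output es σ →
    let H = support (σ current) ∪ ⁅ u ⁆ in Good H →
    Run n 500 addEdge σ λ τ → support (τ current) ≡ H ×
      ∃[ fs ] Output (es ++ fs) τ × H ∈ˡ es ++ fs × length fs ≤ 1
  run-addEdge σ u {es} ld u≡ o good = weaken (run-set⨾ (
    run-seq (run-copy σ₁ current work ld)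
      λ {τ₁} f₁ w≡ → run-seq (run-tally τ₁ (loaded-frame f₁ ld))
      λ {τ₂} f₂ t≡ → run-seq (run-code τ₂ (loaded-frame f₂ (loaded-frame f₁ ld)))
      λ {τ₃} f₃ k≡ →
        let ld₃ = loaded-frame f₃ (loaded-frame f₂ (loaded-frame f₁ ld))
            o₃ = output-frame f₃ (output-frame f₂ (output-frame f₁ o))
            W≡ = trans (cong support (trans (same f₃ work) (same f₂ work))) (trans w≡ H≡)
            key≡ = trans k≡ (cong (key n) (sym (same f₃ work)))
            C≡ = trans (cong support (trans (same f₃ current) (trans (same f₂ current) (same f₁ current)))) H≡
        in run-if
          (λ ≢0 → run-skip (C≡ , [] , subst (λ l → Output l τ₃) (sym (++-identityʳ es)) o₃ ,
                     ∈-++⁺ˡ (subst (_∈ˡ es) W≡ (seen⁻ o₃ (τ₃ work) (subst (λ k → τ₃ seen k ≢ 0) key≡ ≢0))) , z≤n))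
          (λ ≡0 → run-set⨾ (run-set⨾ (conseq
            (run-emit _ {concatMap encodeSet es} ld₃ (written o₃)
              (trans (at-zero (same f₃ tally)) (trans t≡ (cong (λ f → ∣ support {n} f ∣) (sym (trans (same f₃ work) (same f₂ work)))))))
            λ {τ₄} f₄ wr →
              trans (cong support (same f₄ current)) C≡ , [ H ] ,
              subst (λ S → Output (es ++ [ S ]) τ₄) W≡
                (transport (cong (λ k → update (τ₃ seen) k 1) (sym key≡)) (same f₄ seen) (at-zero (same f₄ edgeCount))
                  (output-push (τ₃ work) o₃ (λ ∈es → seen⁺ o₃ (τ₃ work) ∈es (subst (λ k → τ₃ seen k ≡ 0) key≡ ≡0))
                    (λ {M} {v} → subst Good (sym W≡) (λ {M} {v} → good {M} {v}) {M} {v}) wr)) ,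
              ∈-++⁺ʳ es (here refl) , ≤-refl)))))
    where
    H = support (σ current) ∪ ⁅ u ⁆
    σ₁ = σ [ current , σ found 0 ∸ 1 ↦ 1 ]
    H≡ : support (σ₁ current) ≡ H
    H≡ = support-insert u (cong (_∸ 1) u≡)
    transport : ∀ {fs out sn sn′ sn″ p k k′} → sn ≡ sn′ → sn″ ≡ sn′ → k′ ≡ k →
                OutputState fs out sn p k → OutputState fs out sn″ p k′
    transport refl refl refl o = o

  -- The rounds for one clause.

  -- The form of `Covered` that survives a round: it speaks of all of `T`, and becomes `Covered`
  -- once `T` contains the head.
  Implied : List (Subset n) → Clause n → Subset n → Set
  Implied es C T = ∀ M → EdgeModel es M → (∀ {C′} → C′ ∈ˡ Ψ → Smaller (size C) C′ → Sat C′ M) →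
                   body C ⊆ M → T ⊆ M

  -- The alternative n ≤ ∣ T ∣ + i of the last component becomes F (body C) ⊆ T once
  -- no round is left, so n rounds always suffice.

  Growing : List (Subset n) → Clause n → ℕ → Subset n → ℕ → Set
  Growing es C i T fail =
    body C ⊆ T × T ⊆ F (body C) × Implied es C T × (fail ≡ 0 → F (body C) ⊆ T ⊎ n ≤ ∣ T ∣ + i)

  module Rounds {C} (C∈ : C ∈ˡ Ψ) (es : List (Subset n)) (σ : Store) (ld : Loaded σ)
                (ms : Measured Ψ (σ sizes)) (size≡ : σ sizes (σ cidx 0) ≡ size C)
                (goal≡ : support (σ goal) ≡ F (body C)) where

    B Z : Subset n
    B = body C
    Z = F B

    Inv : ℕ → Store → Set
    -- Each round lists at most one edge, so new edges and rounds left together stay within n; this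
    -- yields at most n edges per clause.
    Inv i τ = ∃[ fs ] Output (es ++ fs) τ × length fs + i ≤ n ×
              (τ failed 0 ≢ 0 → ¬ HypergraphHorn ⟦ Ψ ⟧) × (τ failed 0 ≡ 0 → σ failed 0 ≡ 0) ×
              Growing (es ++ fs) C i (support (τ current)) (τ failed 0)

    module Advance {i fs T T′} (c : Closure (Smaller (size C)) Ψ T T′)
                   {fail} (gr : Growing (es ++ fs) C (suc i) T fail) where

      B⊆T′ : B ⊆ T′
      B⊆T′ x∈ = extends c (proj₁ gr x∈)

      T′⊆Z : T′ ⊆ Z
      T′⊆Z = least c Z (λ C′∈ _ → closed (F-closure B) C′∈ tt) (proj₁ (proj₂ gr))

      implied : Implied (es ++ fs) C T′
      implied M em cl B⊆M = least c M cl (proj₁ (proj₂ (proj₂ gr)) M em cl B⊆M)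

      done : Z ⊆ T′ → Growing (es ++ fs) C i T′ fail
      done Z⊆T′ = B⊆T′ , T′⊆Z , implied , λ _ → inj₁ Z⊆T′

      -- The loop has no early exit. Once the flag is raised, the promise about the final `T` is
      -- vacuous and only the other components are carried along.
      gave-up : ∀ {fail′} → fail′ ≢ 0 → Growing (es ++ fs) C i T′ fail′
      gave-up ≢0 = B⊆T′ , T′⊆Z , implied , λ ≡0 → contradiction ≡0 ≢0

      -- The new edge without u is contained in `T′`, which is already implied, so the edge yields
      -- u. The strict growth compensates for the round used up.
      grown : ∀ {u} gs → u ∈ Z → u ∉ T′ → T′ ∪ ⁅ u ⁆ ∈ˡ (es ++ fs) ++ gs →
              Growing ((es ++ fs) ++ gs) C i (T′ ∪ ⁅ u ⁆) fail
      grown {u} gs u∈Z u∉T′ H∈ =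
        (λ x∈ → x∈p∪q⁺ (inj₁ (B⊆T′ x∈))) ,
        ∪⁅⁆-least T′⊆Z u∈Z ,
        (λ M em cl B⊆M →
          let T′⊆M = implied M (λ H∈ → em (∈-++⁺ˡ H∈)) cl B⊆M
          in ∪⁅⁆-least T′⊆M (em H∈ u∈H λ x∈ → case x∈p∪q⁻ T′ ⁅ u ⁆ (p─q⊆p _ ⁅ u ⁆ x∈) of λ
               { (inj₁ x∈T′) → T′⊆M x∈T′
               ; (inj₂ x∈u)  → contradiction (x∈⁅y⁆⇒x≡y u x∈u) (x∈p-y⇒x≢y x∈) })) ,
        λ ≡0 → progress (proj₂ (proj₂ (proj₂ gr)) ≡0)
        where
        u∈H : u ∈ T′ ∪ ⁅ u ⁆
        u∈H = x∈p∪q⁺ (inj₂ (x∈⁅x⁆ u))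
        progress : Z ⊆ T ⊎ n ≤ ∣ T ∣ + suc i → Z ⊆ T′ ∪ ⁅ u ⁆ ⊎ n ≤ ∣ T′ ∪ ⁅ u ⁆ ∣ + i
        progress (inj₁ Z⊆T) = inj₁ λ x∈ → x∈p∪q⁺ (inj₁ (extends c (Z⊆T x∈)))
        progress (inj₂ n≤)  = inj₂ (≤-trans n≤ (≤-trans (≤-reflexive (+-suc _ i)) (+-monoˡ-≤ i
          (≤-<-trans (p⊆q⇒∣p∣≤∣q∣ (extends c))
            (⊈⇒< (λ x∈ → x∈p∪q⁺ (inj₁ x∈)) λ ⊆T′ → u∉T′ (⊆T′ u∈H))))))

    run-round : ∀ {i τ} → Frame (for stage numVars round) σ τ → i < n → τ stage 0 ≡ i → Inv (suc i) τ →
                Run (n * (n * (n * L))) 1900 round τ (Inv i)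
    run-round {i} {τ} fr _ _ (fs , o , len , nohorn , fail₀ , gr) = weaken (
      run-seq (rescale n≤n³L (run-copy τ current work ldτ))
      λ {τ₁} f₁ w≡ → run-set⨾ (run-seq (rescale nL≤n³L (run-close _ {Smaller (size C)} (loaded-frame f₁ ldτ)
        (subst₂ (λ f k → AllAt (Enabled f k (Smaller (size C))) 0 Ψ) (sym (trans (same f₁ sizes) (same fr sizes)))
          (sym (trans (cong₂ (λ f g → f (g 0)) (trans (same f₁ sizes) (same fr sizes)) (trans (same f₁ cidx) (same fr cidx))) size≡))
          (enabled-smaller (size C) Ψ 0 (proj₁ ms)))))
      λ {τ₂} f₂ cl → run-seq (rescale n≤n³L (run-copy τ₂ work current (loaded-frame f₂ (loaded-frame f₁ ldτ))))
      λ {τ₃} f₃ c≡ → run-set⨾ (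
        let ld₃ = loaded-frame f₃ (loaded-frame f₂ (loaded-frame f₁ ldτ))
            sz₃ = trans (same f₃ sizes) (trans (same f₂ sizes) (trans (same f₁ sizes) (same fr sizes)))
            un = unlimited (cong suc (num-vars τ₃ ld₃)) (λ j → subst (λ f → f j ≤ n) (sym sz₃) (proj₂ ms j))
        in run-seq (run-search _ ld₃ un)
      λ {τ₄} f₄ (sub , miss , stuck , fnd) →
        let ld₄ = loaded-frame f₄ ld₃
            o₄ = output-frame f₄ (output-frame f₃ (output-frame f₂ (output-frame f₁ o)))
            fail₄ = at-zero (trans (same f₄ failed) (trans (same f₃ failed) (trans (same f₂ failed) (same f₁ failed))))
            Z≡ = trans (cong support (trans (same f₃ goal) (trans (same f₂ goal) (trans (same f₁ goal) (same fr goal))))) goal≡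
            T≡ = cong support (same f₄ current)
            cl′ = subst₂ (Closure (Smaller (size C)) Ψ) w≡ (trans (sym c≡) (sym T≡)) cl
            gr′ = subst (Growing (es ++ fs) C (suc i) (support (τ current))) (sym fail₄) gr
            open Advance {i} {fs} cl′ gr′
            len′ = ≤-trans (+-monoʳ-≤ (length fs) (n≤1+n i)) len
        in run-if
          (λ m≢0 → run-if
            (λ f≢0 → rescale n≤n³L (
              let u , u≡ , u∈Z₀ , u∉T₀ , red = fnd f≢0
                  u∈Z = subst (u ∈_) Z≡ u∈Z₀
                  u∉T = subst (u ∉_) (sym T≡) u∉T₀
              in conseq (run-addEdge τ₄ u ld₄ u≡ o₄
                   (good-edge B⊆T′ u∈Z u∉T λ {w} w∈ → subst (λ S → Redundant S u w) (sym T≡) (red (subst (w ∈_) T≡ w∈))))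
                 λ {τ₅} f₅ (H≡ , gs , o₅ , H∈ , len₁) →
                   let fail₅ = trans (at-zero (same f₅ failed)) fail₄
                   in fs ++ gs , subst (λ l → Output l τ₅) (++-assoc es fs gs) o₅ ,
                      (let open ≤-Reasoning in begin
                        length (fs ++ gs) + i       ≡⟨ cong (_+ i) (length-++ fs) ⟩
                        length fs + length gs + i   ≤⟨ +-monoˡ-≤ i (+-monoʳ-≤ (length fs) len₁) ⟩
                        length fs + 1 + i           ≡⟨ +-assoc (length fs) 1 i ⟩
                        length fs + suc i           ≤⟨ len ⟩
                        n                           ∎) ,
                      (λ z → nohorn (subst (_≢ 0) fail₅ z)) , (λ z → fail₀ (trans (sym fail₅) z)) ,
                      subst (λ l → Growing l C i (support (τ₅ current)) (τ₅ failed 0)) (++-assoc es fs gs)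
                        (subst₂ (Growing ((es ++ fs) ++ gs) C i) (sym H≡) (sym (at-zero (same f₅ failed)))
                          (grown gs u∈Z u∉T H∈))))
            (λ f≡0 → run-set (fs , o₄ , len′ ,
              (λ _ → case miss m≢0 of λ (u , u∈Z , u∉T) →
                 stuck⇒¬horn B⊆T′ T′⊆Z (closed cl′) (subst (u ∈_) Z≡ u∈Z) (subst (u ∉_) (sym T≡) u∉T)
                   (subst₂ Stuck Z≡ (sym T≡) (stuck f≡0))) ,
              (λ ()) , gave-up λ ())))
          (λ m≡0 → run-skip (fs , o₄ , len′ , (λ z → nohorn (subst (_≢ 0) fail₄ z)) , (λ z → fail₀ (trans (sym fail₄) z)) ,
            done λ x∈ → subst (_ ∈_) (sym T≡) (sub m≡0 (subst (_ ∈_) (sym Z≡) x∈)))))))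
      where
      ldτ : Loaded τ
      ldτ = loaded-frame fr ld

  -- All clauses and the answer.

  at-lookup : ∀ {a} q xs {y ys} → At a q (xs ++ y ∷ ys) → a (q + length xs) ≡ y
  at-lookup {a} q []       (e , _) = trans (cong a (+-identityʳ q)) e
  at-lookup {a} q (_ ∷ xs) (_ , h) = trans (cong a (+-suc q (length xs))) (at-lookup (suc q) xs h)

  Processed : CNF n → List (Subset n) → Store → Set
  Processed pre es τ = Output es τ × length es ≤ n * length pre ×
                       (τ failed 0 ≢ 0 → ¬ HypergraphHorn ⟦ Ψ ⟧) × (τ failed 0 ≡ 0 → All (Covered es) pre)

  run-process : ∀ σ pre C Cs {es} → pre ++ C ∷ Cs ≡ Ψ → Loaded σ → Measured Ψ (σ sizes) → σ cidx 0 ≡ length pre →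
    At (σ input) (σ pos 0) (concatMap encodeClause (C ∷ Cs)) → Processed pre es σ →
    Run n⁴L 3000 process σ λ τ → At (σ input) (τ pos 0) (concatMap encodeClause Cs) ×
      τ cidx 0 ≡ length (pre ++ [ C ]) × ∃[ es′ ] Processed (pre ++ [ C ]) es′ τ
  run-process σ pre C Cs {es} eq ld ms c≡ rd (o , len , nohorn , cov) = weaken (
    run-seq (rescale n≤n⁴L (run-load σ C ld rd))
    λ {τ₁} f₁ (w≡ , rd₁) → let ld₁ = loaded-frame f₁ ld in
    run-seq (rescale n≤n⁴L (run-copy τ₁ work current ld₁))
    λ {τ₂} f₂ t≡ → let ld₂ = loaded-frame f₂ ld₁ in
    run-set⨾ (run-seq (rescale nL≤n⁴L (run-F _ ld₂ (unlimited (cong suc (num-vars τ₂ ld₂))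
      (λ j → subst (λ f → f j ≤ n) (sym (trans (same f₂ sizes) (same f₁ sizes))) (proj₂ ms j)))))
    λ {τ₃} f₃ F≡ → let ld₃ = loaded-frame f₃ ld₂ in
    run-seq (rescale n≤n⁴L (run-copy τ₃ work goal ld₃))
    λ {τ₄} f₄ z≡ →
      let ld₄ = loaded-frame f₄ ld₃
          sz≡ = trans (same f₄ sizes) (trans (same f₃ sizes) (trans (same f₂ sizes) (same f₁ sizes)))
          ms₄ = subst (Measured Ψ) (sym sz≡) ms
          ci≡ = trans (at-zero (trans (same f₄ cidx) (trans (same f₃ cidx) (trans (same f₂ cidx) (same f₁ cidx))))) c≡
          size≡ = trans (cong (τ₄ sizes) (trans ci≡ (sym (length-map size pre))))
                    (at-lookup 0 (map size pre) (subst (At (τ₄ sizes) 0) (trans (cong (map size) (sym eq)) (map-++ size pre (C ∷ Cs))) (proj₁ ms₄)))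
          goal≡ = trans z≡ (trans F≡ (cong F (trans (cong support (same f₂ work)) w≡)))
          cur≡ = trans (cong support (trans (same f₄ current) (same f₃ current))) (trans t≡ w≡)
          fail≡ = at-zero (trans (same f₄ failed) (trans (same f₃ failed) (trans (same f₂ failed) (same f₁ failed))))
          C∈ = subst (C ∈ˡ_) eq (∈-++⁺ʳ pre (here refl))
          o₄ = output-frame f₄ (output-frame f₃ (output-frame f₂ (output-frame f₁ o)))
          open Rounds C∈ es τ₄ ld₄ ms₄ size≡ goal≡
      in run-seq (run-for {X = n * (n * (n * L))} Inv (λ i → i) run-round (num-vars τ₄ ld₄)
           ([] , subst (λ l → Output l τ₄) (sym (++-identityʳ es)) o₄ , ≤-refl ,
            (λ z → nohorn (subst (_≢ 0) fail≡ z)) , id ,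
            (λ x∈ → subst (_ ∈_) (sym cur≡) x∈) ,
            (λ x∈ → extends (F-closure (body C)) (subst (_ ∈_) cur≡ x∈)) ,
            (λ M em cl B⊆M x∈ → B⊆M (subst (_ ∈_) cur≡ x∈)) ,
            λ _ → inj₂ (m≤n+m n _)))
    λ {τ₅} f₅ (fs , o₅ , len₅ , nohorn₅ , fail₅ , (_ , T⊆Z , imp , fin)) →
      run-set (subst (λ k → At (σ input) k (concatMap encodeClause Cs))
                (sym (at-zero (trans (same f₅ pos) (trans (same f₄ pos) (trans (same f₃ pos) (same f₂ pos)))))) rd₁ ,
               trans (cong suc (trans (at-zero (same f₅ cidx)) ci≡)) length-snoc ,
               es ++ fs , o₅ ,
               (let open ≤-Reasoning in begin
                 length (es ++ fs)             ≡⟨ length-++ es ⟩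
                 length es + length fs         ≤⟨ +-mono-≤ len (≤-trans (m≤m+n (length fs) 0) len₅) ⟩
                 n * length pre + n            ≡⟨ +-comm _ n ⟩
                 n + n * length pre            ≡⟨ *-suc n (length pre) ⟨
                 n * suc (length pre)          ≡⟨ cong (n *_) length-snoc ⟩
                 n * length (pre ++ [ C ])     ∎) ,
               nohorn₅ ,
               -- The flag is never lowered, so 0 at the end means 0 before; earlier clauses were
               -- then covered, and additional edges keep them so.
               λ z → All-++ (All.map (λ {C′} → covered-++ {C = C′} fs) (cov (trans (sym fail≡) (fail₅ z))))
                 (covers imp (fin z) ∷ []))))
    where
    length-snoc : suc (length pre) ≡ length (pre ++ [ C ])
    length-snoc = trans (+-comm 1 (length pre)) (sym (length-++ pre))

    covers : ∀ {es T} → Implied es C T → F (body C) ⊆ T ⊎ n ≤ ∣ T ∣ + 0 → Covered es C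
    covers {T = T} imp fin em cl B⊆M = imp _ em cl B⊆M (head∈T fin)
      where
      head∈T : F (body C) ⊆ T ⊎ n ≤ ∣ T ∣ + 0 → head C ∈ T
      head∈T (inj₁ Z⊆T) = Z⊆T (closed (F-closure (body C)) C∈Ψ tt (extends (F-closure (body C))))
        where
        C∈Ψ : C ∈ˡ Ψ
        C∈Ψ = subst (C ∈ˡ_) eq (∈-++⁺ʳ pre (here refl))
      head∈T (inj₂ n≤) = subst (head C ∈_) (sym (∣p∣≡n⇒p≡⊤ (≤-antisym (∣p∣≤n T) (≤-trans n≤ (≤-reflexive (+-identityʳ _)))))) ∈⊤

  run-generate : ∀ σ → Loaded σ → Measured Ψ (σ sizes) → (∀ i → σ seen i ≡ 0) → σ edgeCount 0 ≡ 0 → σ failed 0 ≡ 0 →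
    Run (suc (sum (map (λ _ → n⁴L) Ψ))) 3100 generate σ λ τ → ∃[ es ] Processed Ψ es τ
  run-generate σ ld ms seen0 count0 fail0 = weaken (run-set⨾ (run-set⨾ (run-set⨾ (conseq
    (run-for-list Inv (λ _ → n⁴L) (λ i → i) step Ψ (num-clauses σ ld)
      ([] , [] , refl , input-clauses σ ld , refl ,
       record { written = tt , refl ; counted = count0 ; seen⁻ = λ a ≢0 → contradiction (seen0 (key n a)) ≢0
              ; seen⁺ = λ _ () ; unique = [] ; sound = [] } ,
       z≤n , (λ z → contradiction fail0 z) , λ _ → []))
    λ { {τ} _ (pre , es , eq , _ , _ , pr) → es , subst (λ Cs → Processed Cs es τ) (trans (sym (++-identityʳ pre)) eq) pr }))))
    where
    Inv : CNF n → Store → Set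
    Inv Cs τ = ∃[ pre ] ∃[ es ] pre ++ Cs ≡ Ψ × At (σ input) (τ pos 0) (concatMap encodeClause Cs) ×
               τ cidx 0 ≡ length pre × Processed pre es τ
    σ₀ = ((σ [ pos , 0 ↦ 2 ]) [ cidx , 0 ↦ 0 ]) [ outPtr , 0 ↦ 2 ]
    step : ∀ C Cs {τ} → Frame (for outer numClauses process) σ₀ τ → τ outer 0 ≡ length Cs →
           Inv (C ∷ Cs) τ → 1 ≤ n⁴L × Run n⁴L 3000 process τ (Inv Cs)
    step C Cs {τ} fr _ (pre , es , eq , rd , c≡ , pr) = >-nonZero⁻¹ n⁴L ,
      conseq (run-process τ pre C Cs eq (loaded-frame fr ld) (subst (Measured Ψ) (sym (same fr sizes)) ms) c≡
               (subst (λ f → At f (τ pos 0) (concatMap encodeClause (C ∷ Cs))) (sym (same fr input)) rd) pr)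
      λ {τ′} _ (rd′ , c≡′ , es′ , pr′) → pre ++ [ C ] , es′ , trans (++-assoc pre [ C ] Cs) eq ,
        subst (λ f → At f (τ′ pos 0) (concatMap encodeClause Cs)) (same fr input) rd′ , c≡′ , pr′

  Answer : Store → Set
  Answer σ = (¬ HypergraphHorn ⟦ Ψ ⟧ × Outputs σ answerNo)
           ⊎ (∃[ ℋ ] ⟦ Ψ ⟧ ≗ ⟦ Φ ℋ ⟧ × card ℋ ≤ n * length Ψ × Outputs σ (answerYes ℋ))

  run-answer : ∀ σ {es} → Processed Ψ es σ → Run 1 30 answer σ Answer
  run-answer σ {es} (o , len , nohorn , cov) = weaken (run-if
    (λ ≢0 → run-set (inj₁ (nohorn ≢0 , refl)))
    (λ ≡0 → run-set⨾ (run-set (inj₂ (hypergraph es (unique o) ,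
      represents (hypergraph es (unique o)) (sound o) (cov ≡0) , len ,
      at-applyUpTo {q = 0} (answerYes (hypergraph es (unique o))) (λ _ → refl)
        (refl , counted o , at-below _ ≤-refl (at-below _ z<s (proj₁ (written o)))))))))

  run-main : Run (suc (sum (map (λ _ → n⁴L) Ψ))) main-bound main (initial (encodeCNF Ψ)) Answer
  -- The constants of the three phases are 600, 3100 and 30.
  run-main = weaken {le = main-bound-large tt} (
    run-seq (run-measureAll (initial (encodeCNF Ψ)) refl λ _ → refl)
    λ f₁ ms → run-seq (run-generate _ (loaded-frame f₁ refl) ms
      (λ i → cong (λ f → f i) (same f₁ seen)) (at-zero (same f₁ edgeCount)) (at-zero (same f₁ failed)))
    λ _ (_ , pr) → rescale (s≤s z≤n) (run-answer _ pr))

  time-scale : _≡_ {A = ℕ} (suc (sum (map (λ _ → n⁴L) Ψ))) (suc (n ^ 4 * length Ψ * L))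
  time-scale = cong suc (trans (sum-const Ψ n⁴L) (solve 3
    (λ n m l → m :* (n :* (n :* (n :* (n :* l)))) := n :* (n :* (n :* (n :* con 1))) :* m :* l) refl n (length Ψ) L))
    where open +-*-Solver

-- The empty CNF, and the conclusion.

run-none : ∀ σ {x e b} → eval e σ ≡ 0 → Run 1 (5 + cost e) (for x e b) σ (λ τ → τ ≡ σ [ x , 0 ↦ eval e σ ])
run-none σ {x} {e} e≡0 = ran (⇓seq ⇓set (⇓done (trans (set-hit σ x 0 (eval e σ)) e≡0)))
  (≤-reflexive (trans (+-comm (2 + cost e) 3) (sym (*-identityʳ (5 + cost e))))) refl

-- Without clauses `L` is 0 and the product scales vanish, and n itself may be 0. Both outer loops
-- are idle, and the `suc` in the claimed bound pays for the constant time that remains.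
run-empty : ∀ σ → eval numClauses σ ≡ 0 → σ failed 0 ≡ 0 → σ edgeCount 0 ≡ 0 →
            Run 1 main-bound main σ (λ τ → Outputs τ (1 ∷ 0 ∷ []))
run-empty σ m≡0 fail≡0 count≡0 = weaken {le = main-bound-large tt} (
  run-seq (run-set⨾ (run-set⨾ (run-set⨾ (run-none _ m≡0))))
  λ { _ refl → run-seq (run-set⨾ (run-set⨾ (run-set⨾ (run-none _ m≡0))))
  λ { _ refl → run-if
    (λ ≢0 → run-set (contradiction fail≡0 ≢0))
    (λ _ → run-set⨾ (run-set (cong (λ k → 1 ∷ k ∷ []) count≡0))) } })

outcome : ∀ {X Y p σ Q} → X ≡ Y → Run X main-bound p σ Q →
          ∃[ t ] ∃[ τ ] (p , σ ⇓[ t ] τ) × t ≤ main-bound * Y × Q τ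
outcome refl (ran d b h) = _ , _ , d , b , h

theorem22 : ∃[ p ] ∃[ c ] ∀ (n : ℕ) (Ψ : CNF n) →
    ∃[ t ] ∃[ σ ]
    (p , initial (encodeCNF Ψ) ⇓[ t ] σ)
    × t ≤ c * suc (n ^ 4 * length Ψ * ∥ Ψ ∥)
    × ( (¬ HypergraphHorn ⟦ Ψ ⟧ × Outputs σ answerNo)
    ⊎ (∃[ ℋ ] ⟦ Ψ ⟧ ≗ ⟦ Φ ℋ ⟧ × card ℋ ≤ n * length Ψ × Outputs σ (answerYes ℋ)) )
theorem22 = main , main-bound , correct
  where
  correct : ∀ n (Ψ : CNF n) → ∃[ t ] ∃[ σ ]
    (main , initial (encodeCNF Ψ) ⇓[ t ] σ)
    × t ≤ main-bound * suc (n ^ 4 * length Ψ * ∥ Ψ ∥)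
    × ( (¬ HypergraphHorn ⟦ Ψ ⟧ × Outputs σ answerNo)
    ⊎ (∃[ ℋ ] ⟦ Ψ ⟧ ≗ ⟦ Φ ℋ ⟧ × card ℋ ≤ n * length Ψ × Outputs σ (answerYes ℋ)) )
  correct n [] = outcome (cong suc (sym (*-zeroʳ (n ^ 4 * 0))))
    (conseq (run-empty (initial (encodeCNF {n} [])) refl refl refl) λ _ out → inj₂ (hypergraph [] [] , (λ _ → refl) , z≤n , out))
  correct n Ψ@(C ∷ _) = outcome (Algorithm.time-scale Ψ) (Algorithm.run-main Ψ)
    where
    instance
      n≢0 : NonZero n
      n≢0 = >-nonZero (≤-<-trans z≤n (toℕ<n (head C)))
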